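{- For every directed social network $G(V,E,w)$, the generalized IE strategy $\mathrm{IE}(\vec{q},\vec{p})$ with $K = 6$ pricing classes and assignment probabilities $\vec{q} = (0.183, 0.075, 0.075, 0.175, 0.261, 0.231)$ approximates the maximum revenue of $G$ within a factor of $0.3516$; that is, its expected revenue is at least $0.3516\cdot R_{\max}(G)$.
   Context: A directed social network $G(V,E,w)$ on a finite set $V$ of $n$ buyers has real weights $w_{ij} \geq 0$ for ordered pairs of distinct buyers, with $w_{ij}>0$ exactly when $(i,j)\in E$; for directed networks there are no loops, i.e., $w_{ii}=0$. Marketing strategies (Uniform Additive Model). A marketing strategy $(\vec{\pi},\vec{p})$ consists of a permutation $\vec{\pi}$ of $V$ ($\pi_i$ is the position of buyer $i$) and a vector of pricing probabilities $p_i \in [1/2,1]$, $i\in V$. Its expected revenue is $$R(\vec{\pi},\vec{p}) = \sum_{i\in V} p_i(1-p_i)\sum_{j:\pi_j<\pi_i} p_j w_{ji},$$ and $R_{\max}(G) = \max_{(\vec{\pi},\vec{p})} R(\vec{\pi},\vec{p})$ is the maximum revenue of $G$. Generalized IE strategies. Let $K\ge 2$ be an integer. Class $k\in\{1,\ldots,K\}$ has pricing probability $p_k = 1-\frac{k-1}{2(K-1)}$, and $\vec{q}=(q_1,\ldots,q_K)$ is a probability vector. The generalized IE strategy $\mathrm{IE}(\vec{q},\vec{p})$ assigns each buyer independently to class $k$ with probability $q_k$; a buyer assigned to class $k$ gets pricing probability $p_k$. Buyers in class $k$ are approached before buyers in class $k+1$ for $k=1,\ldots,K-1$, and buyers within the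 same class are approached in uniformly random order. Its expected revenue is the expectation of $R(\cdot,\cdot)$, for the resulting random permutation and pricing probabilities, over the random assignment and the random orders. -}

module Defs where

open import Algebra.Bundles.Raw using (RawRing)
import Algebra.Definitions.RawMonoid as RawMonoidDefinitions
open import Data.Bool.Base using (if_then_else_)
open import Data.Fin.Base as Fin using (Fin; zero; suc; toℕ)
import Data.Fin.Properties as Fin
open import Data.Fin.Permutation using (Permutation′; _⟨$⟩ʳ_; insert)
  renaming (id to idPermutation)
open import Data.Integer.Base using (+_)
open import Data.List.Base as List using (List; []; _∷_; [_])
open import Data.Nat.Base as ℕ using (ℕ; zero; suc; _⊔_)
import Data.Nat.Properties as ℕ
open import Data.Product.Base using (Σ-syntax; ∃-syntax; _×_; _,_)
open import Data.Rational.Base as ℚ using (ℚ; 0ℚ; 1ℚ; ½)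
import Data.Rational.Properties as ℚ
open import Data.Rational.Solver using (module +-*-Solver)
open import Data.Vec.Functional as Vector using (Vector)
open import Function.Base using (_∘_)
open import Function.Bundles using (_⇔_)
open import Level using (0ℓ)
open import Relation.Binary.Core using (Rel)
open import Relation.Binary.PropositionalEquality
  using (_≡_; refl; sym; trans; cong; subst)
open import Relation.Nullary.Decidable using (Dec; does; _→-dec_)

-- Real numbers as Cauchy sequences of rationals, considered up to _≃_.

IsCauchy : (ℕ → ℚ) → Set
IsCauchy s = ∀ ε → 0ℚ ℚ.< ε →
  ∃[ N ] ∀ m n → N ℕ.≤ m → N ℕ.≤ n → ℚ.∣ s m ℚ.- s n ∣ ℚ.≤ ε

Eventually : (ℕ → Set) → Set
Eventually P = ∃[ N ] ∀ n → N ℕ.≤ n → P n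

record ℝ : Set where
  constructor mkℝ
  field
    seq    : ℕ → ℚ
    cauchy : IsCauchy seq

open ℝ public

infix 4 _≃_ _≤_ _<_

record _≃_ (x y : ℝ) : Set where
  constructor mk≃
  field close : ∀ ε → 0ℚ ℚ.< ε → Eventually λ n → ℚ.∣ seq x n ℚ.- seq y n ∣ ℚ.≤ ε

record _≤_ (x y : ℝ) : Set where
  constructor mk≤
  field below : ∀ ε → 0ℚ ℚ.< ε → Eventually λ n → seq x n ℚ.≤ seq y n ℚ.+ ε

record _<_ (x y : ℝ) : Set where
  constructor mk<
  field
    gap       : ℚ
    0<gap     : 0ℚ ℚ.< gap
    separated : Eventually λ n → seq x n ℚ.+ gap ℚ.≤ seq y n

open _≃_ public
open _≤_ public
open _<_ public

-- Only the convergence proofs are abstract; seq computes.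
abstract
  const-cauchy : ∀ q → IsCauchy (λ _ → q)
  const-cauchy q ε 0<ε = 0 , λ _ _ _ _ →
    subst (ℚ._≤ ε) (sym (cong ℚ.∣_∣ (ℚ.+-inverseʳ q))) (ℚ.<⇒≤ 0<ε)

  +-cauchy : ∀ s t → IsCauchy s → IsCauchy t → IsCauchy (λ n → s n ℚ.+ t n)
  +-cauchy s t cs ct ε 0<ε =
    let (M , hs) = cs δ 0<δ
        (N , ht) = ct δ 0<δ
    in M ⊔ N , λ m n ≤m ≤n → begin
      ℚ.∣ (s m ℚ.+ t m) ℚ.- (s n ℚ.+ t n) ∣
        ≡⟨ cong ℚ.∣_∣ (regroup (s m) (t m) (s n) (t n)) ⟩
      ℚ.∣ (s m ℚ.- s n) ℚ.+ (t m ℚ.- t n) ∣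
        ≤⟨ ℚ.∣p+q∣≤∣p∣+∣q∣ (s m ℚ.- s n) (t m ℚ.- t n) ⟩
      ℚ.∣ s m ℚ.- s n ∣ ℚ.+ ℚ.∣ t m ℚ.- t n ∣
        ≤⟨ ℚ.+-mono-≤
             (hs m n (ℕ.m⊔n≤o⇒m≤o M N ≤m) (ℕ.m⊔n≤o⇒m≤o M N ≤n))
             (ht m n (ℕ.m⊔n≤o⇒n≤o M N ≤m) (ℕ.m⊔n≤o⇒n≤o M N ≤n)) ⟩
      δ ℚ.+ δ
        ≡⟨ halves ⟩
      ε ∎
    where
    open ℚ.≤-Reasoning
    δ : ℚ
    δ = ½ ℚ.* ε
    0<δ : 0ℚ ℚ.< δ
    0<δ = subst (ℚ._< δ) (ℚ.*-zeroʳ ½) (ℚ.*-monoʳ-<-pos ½ 0<ε)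
    halves : δ ℚ.+ δ ≡ ε
    halves = trans (sym (ℚ.*-distribʳ-+ ε ½ ½)) (ℚ.*-identityˡ ε)
    regroup : ∀ a b c d → (a ℚ.+ b) ℚ.- (c ℚ.+ d) ≡ (a ℚ.- c) ℚ.+ (b ℚ.- d)
    regroup = solve 4 (λ a b c d → (a :+ b) :- (c :+ d) := (a :- c) :+ (b :- d)) refl
      where open +-*-Solver

  neg-cauchy : ∀ s → IsCauchy s → IsCauchy (λ n → ℚ.- s n)
  neg-cauchy s cs ε 0<ε =
    let (N , h) = cs ε 0<ε
    in N , λ m n ≤m ≤n → subst (ℚ._≤ ε) (sym (∣-∣ (s m) (s n))) (h m n ≤m ≤n)
    where
    ∣-∣ : ∀ a b → ℚ.∣ ℚ.- a ℚ.- ℚ.- b ∣ ≡ ℚ.∣ a ℚ.- b ∣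
    ∣-∣ a b = trans (cong ℚ.∣_∣ (sym (ℚ.neg-distrib-+ a (ℚ.- b)))) (ℚ.∣-p∣≡∣p∣ (a ℚ.- b))

Bounded : (ℕ → ℚ) → Set
Bounded s = Σ[ B ∈ ℚ ] (0ℚ ℚ.< B × Eventually λ n → ℚ.∣ s n ∣ ℚ.≤ B)

abstract
  cauchy⇒bounded : ∀ s → IsCauchy s → Bounded s
  cauchy⇒bounded s cs =
    let (N , h) = cs 1ℚ (ℚ.positive⁻¹ 1ℚ)
    in 1ℚ ℚ.+ ℚ.∣ s N ∣ , ℚ.+-mono-<-≤ (ℚ.positive⁻¹ 1ℚ) (ℚ.0≤∣p∣ (s N)) , N , λ n N≤n → begin
      ℚ.∣ s n ∣
        ≡⟨ cong ℚ.∣_∣ (split (s n) (s N)) ⟩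
      ℚ.∣ (s n ℚ.- s N) ℚ.+ s N ∣
        ≤⟨ ℚ.∣p+q∣≤∣p∣+∣q∣ (s n ℚ.- s N) (s N) ⟩
      ℚ.∣ s n ℚ.- s N ∣ ℚ.+ ℚ.∣ s N ∣
        ≤⟨ ℚ.+-monoˡ-≤ ℚ.∣ s N ∣ (h n N N≤n ℕ.≤-refl) ⟩
      1ℚ ℚ.+ ℚ.∣ s N ∣ ∎
    where
    open ℚ.≤-Reasoning
    split : ∀ a b → a ≡ (a ℚ.- b) ℚ.+ b
    split = solve 2 (λ a b → a := (a :- b) :+ b) refl
      where open +-*-Solver

  *-cauchy : ∀ s t → IsCauchy s → IsCauchy t → IsCauchy (λ n → s n ℚ.* t n)
  *-cauchy s t cs ct ε 0<ε =
    let (Bs , 0<Bs , Ns , hs) = cauchy⇒bounded s cs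
        (Bt , 0<Bt , Nt , ht) = cauchy⇒bounded t ct
        (δ , 0<δ , B*δ≡ε) = divide (Bs ℚ.+ Bt) ε (ℚ.+-mono-< 0<Bs 0<Bt) 0<ε
        (Ms , ks) = cs δ 0<δ
        (Mt , kt) = ct δ 0<δ
    in (Ns ⊔ Nt) ⊔ (Ms ⊔ Mt) , λ m n ≤m ≤n →
      let N≤m = ℕ.m⊔n≤o⇒m≤o (Ns ⊔ Nt) (Ms ⊔ Mt) ≤m
          N≤n = ℕ.m⊔n≤o⇒m≤o (Ns ⊔ Nt) (Ms ⊔ Mt) ≤n
          M≤m = ℕ.m⊔n≤o⇒n≤o (Ns ⊔ Nt) (Ms ⊔ Mt) ≤m
          M≤n = ℕ.m⊔n≤o⇒n≤o (Ns ⊔ Nt) (Ms ⊔ Mt) ≤n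
      in subst (ℚ.∣ s m ℚ.* t m ℚ.- s n ℚ.* t n ∣ ℚ.≤_) B*δ≡ε
        (∣Δ∣≤ (s m) (t m) (s n) (t n) 0<Bs 0<Bt
          (hs m (ℕ.m⊔n≤o⇒m≤o Ns Nt N≤m)) (ht n (ℕ.m⊔n≤o⇒n≤o Ns Nt N≤n))
          (ks m n (ℕ.m⊔n≤o⇒m≤o Ms Mt M≤m) (ℕ.m⊔n≤o⇒m≤o Ms Mt M≤n))
          (kt m n (ℕ.m⊔n≤o⇒n≤o Ms Mt M≤m) (ℕ.m⊔n≤o⇒n≤o Ms Mt M≤n)))
    where
    telescope : ∀ a b c d → a ℚ.* b ℚ.- c ℚ.* d ≡ a ℚ.* (b ℚ.- d) ℚ.+ d ℚ.* (a ℚ.- c)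
    telescope = solve 4 (λ a b c d →
        a :* b :- c :* d := a :* (b :- d) :+ d :* (a :- c)) refl
      where open +-*-Solver

    ∣*∣≤ : ∀ {C δ} a b → 0ℚ ℚ.< C → ℚ.∣ a ∣ ℚ.≤ C → ℚ.∣ b ∣ ℚ.≤ δ →
           ℚ.∣ a ℚ.* b ∣ ℚ.≤ C ℚ.* δ
    ∣*∣≤ {C} {δ} a b 0<C a≤ b≤ = begin
      ℚ.∣ a ℚ.* b ∣          ≡⟨ ℚ.∣p*q∣≡∣p∣*∣q∣ a b ⟩
      ℚ.∣ a ∣ ℚ.* ℚ.∣ b ∣
        ≤⟨ ℚ.*-monoʳ-≤-nonNeg ℚ.∣ b ∣ {{ℚ.nonNegative (ℚ.0≤∣p∣ b)}} a≤ ⟩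
      C ℚ.* ℚ.∣ b ∣
        ≤⟨ ℚ.*-monoˡ-≤-nonNeg C {{ℚ.nonNegative (ℚ.<⇒≤ 0<C)}} b≤ ⟩
      C ℚ.* δ ∎
      where open ℚ.≤-Reasoning

    ∣Δ∣≤ : ∀ {Bx By δ} a b c d → 0ℚ ℚ.< Bx → 0ℚ ℚ.< By →
           ℚ.∣ a ∣ ℚ.≤ Bx → ℚ.∣ d ∣ ℚ.≤ By → ℚ.∣ a ℚ.- c ∣ ℚ.≤ δ → ℚ.∣ b ℚ.- d ∣ ℚ.≤ δ →
           ℚ.∣ a ℚ.* b ℚ.- c ℚ.* d ∣ ℚ.≤ (Bx ℚ.+ By) ℚ.* δ
    ∣Δ∣≤ {Bx} {By} {δ} a b c d 0<Bx 0<By a≤ d≤ ac≤ bd≤ = begin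
      ℚ.∣ a ℚ.* b ℚ.- c ℚ.* d ∣
        ≡⟨ cong ℚ.∣_∣ (telescope a b c d) ⟩
      ℚ.∣ a ℚ.* (b ℚ.- d) ℚ.+ d ℚ.* (a ℚ.- c) ∣
        ≤⟨ ℚ.∣p+q∣≤∣p∣+∣q∣ (a ℚ.* (b ℚ.- d)) (d ℚ.* (a ℚ.- c)) ⟩
      ℚ.∣ a ℚ.* (b ℚ.- d) ∣ ℚ.+ ℚ.∣ d ℚ.* (a ℚ.- c) ∣
        ≤⟨ ℚ.+-mono-≤ (∣*∣≤ a (b ℚ.- d) 0<Bx a≤ bd≤) (∣*∣≤ d (a ℚ.- c) 0<By d≤ ac≤) ⟩
      Bx ℚ.* δ ℚ.+ By ℚ.* δ
        ≡⟨ ℚ.*-distribʳ-+ δ Bx By ⟨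
      (Bx ℚ.+ By) ℚ.* δ ∎
      where open ℚ.≤-Reasoning

    divide : ∀ B ε → 0ℚ ℚ.< B → 0ℚ ℚ.< ε → Σ[ δ ∈ ℚ ] (0ℚ ℚ.< δ × B ℚ.* δ ≡ ε)
    divide B ε 0<B 0<ε = 1/B ℚ.* ε , 0<δ , B*δ≡ε
      where
      instance
        B-positive : ℚ.Positive B
        B-positive = ℚ.positive 0<B
        B-nonZero : ℚ.NonZero B
        B-nonZero = ℚ.pos⇒nonZero B
      1/B : ℚ
      1/B = ℚ.1/ B
      0<δ : 0ℚ ℚ.< 1/B ℚ.* ε
      0<δ = subst (ℚ._< 1/B ℚ.* ε) (ℚ.*-zeroʳ 1/B)
        (ℚ.*-monoʳ-<-pos 1/B {{ℚ.1/pos⇒pos B}} 0<ε)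
      B*δ≡ε : B ℚ.* (1/B ℚ.* ε) ≡ ε
      B*δ≡ε = trans (sym (ℚ.*-assoc B 1/B ε))
        (trans (cong (ℚ._* ε) (ℚ.*-inverseʳ B)) (ℚ.*-identityˡ ε))

fromℚ : ℚ → ℝ
fromℚ q = mkℝ (λ _ → q) (const-cauchy q)

0ℝ 1ℝ : ℝ
0ℝ = fromℚ 0ℚ
1ℝ = fromℚ 1ℚ

infixl 6 _+_ _-_
infixl 7 _*_
infix  8 -_

_+_ : ℝ → ℝ → ℝ
x + y = mkℝ (λ n → seq x n ℚ.+ seq y n) (+-cauchy (seq x) (seq y) (cauchy x) (cauchy y))

-_ : ℝ → ℝ
- x = mkℝ (λ n → ℚ.- seq x n) (neg-cauchy (seq x) (cauchy x))

_-_ : ℝ → ℝ → ℝ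
x - y = x + (- y)

_*_ : ℝ → ℝ → ℝ
x * y = mkℝ (λ n → seq x n ℚ.* seq y n) (*-cauchy (seq x) (seq y) (cauchy x) (cauchy y))

ℝ-rawRing : RawRing 0ℓ 0ℓ
ℝ-rawRing = record
  { Carrier = ℝ
  ; _≈_     = _≃_
  ; _+_     = _+_
  ; _*_     = _*_
  ; -_      = -_
  ; 0#      = 0ℝ
  ; 1#      = 1ℝ
  }

open RawMonoidDefinitions (RawRing.+-rawMonoid ℝ-rawRing) public using (sum)
open RawMonoidDefinitions (RawRing.*-rawMonoid ℝ-rawRing) public
  using () renaming (sum to product)

sumList : List ℝ → ℝ
sumList = List.foldr _+_ 0ℝ

-- Only ever applied below to nonempty lists; the value at [] is a dummy.
mean : List ℝ → ℝ
mean []       = 0ℝ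
mean (x ∷ xs) = fromℚ (+ 1 ℚ./ suc (List.length xs)) * sumList (x ∷ xs)

record DirectedNetwork (n : ℕ) : Set₁ where
  field
    Edge          : Rel (Fin n) 0ℓ
    weight        : Fin n → Fin n → ℝ
    nonNegative   : ∀ i j → 0ℝ ≤ weight i j
    edge⇔positive : ∀ i j → Edge i j ⇔ 0ℝ < weight i j
    loopless      : ∀ i → weight i i ≃ 0ℝ

open DirectedNetwork public

-- π ⟨$⟩ʳ i is the position at which buyer i is approached.
revenue : ∀ {n} → DirectedNetwork n → Permutation′ n → Vector ℝ n → ℝ
revenue G π p = sum λ i →
  p i * (1ℝ - p i) *
  sum λ j → if does (π ⟨$⟩ʳ j Fin.<? π ⟨$⟩ʳ i) then p j * weight G j i else 0ℝ

record Strategy (n : ℕ) : Set where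
  field
    order : Permutation′ n
    price : Vector ℝ n
    ½≤p   : ∀ i → fromℚ ½ ≤ price i
    p≤1   : ∀ i → price i ≤ 1ℝ

strategyRevenue : ∀ {n} → DirectedNetwork n → Strategy n → ℝ
strategyRevenue G s = revenue G (Strategy.order s) (Strategy.price s)

-- Attained, since the maximum revenue is a maximum rather than a supremum. Its
-- existence rests on compactness and is not available constructively.
IsMaximumRevenue : ∀ {n} → DirectedNetwork n → ℝ → Set
IsMaximumRevenue G M =
  (∃[ s ] strategyRevenue G s ≃ M) × (∀ s → strategyRevenue G s ≤ M)

record ProbabilityVector (K : ℕ) : Set where
  field
    prob     : Vector ℝ K
    0≤prob   : ∀ k → 0ℝ ≤ prob k
    sum-prob : sum prob ≃ 1ℝ

open ProbabilityVector public

-- The classes 1, …, K are indexed by k - 1 : Fin K, where K = 2 + m.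
classPrice : ∀ {m} → Vector ℝ (2 ℕ.+ m)
classPrice {m} k = 1ℝ - fromℚ (+ toℕ k ℚ./ (2 ℕ.* suc m))

allAssignments : ∀ n K → List (Vector (Fin K) n)
allAssignments zero    K = [ Vector.[] ]
allAssignments (suc n) K =
  List.cartesianProductWith Vector._∷_ (List.allFin K) (allAssignments n K)

-- Every permutation occurs exactly once up to pointwise equality: choose the
-- position of buyer zero, then the relative order of the others.
allPermutations : ∀ n → List (Permutation′ n)
allPermutations zero    = [ idPermutation ]
allPermutations (suc n) =
  List.cartesianProductWith (insert zero) (List.allFin (suc n)) (allPermutations n)

Compatible : ∀ {n K} → Vector (Fin K) n → Permutation′ n → Set
Compatible c π = ∀ i j → c i Fin.< c j → π ⟨$⟩ʳ i Fin.< π ⟨$⟩ʳ j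

compatible? : ∀ {n K} (c : Vector (Fin K) n) π → Dec (Compatible c π)
compatible? c π = Fin.all? λ i → Fin.all? λ j →
  (c i Fin.<? c j) →-dec (π ⟨$⟩ʳ i Fin.<? π ⟨$⟩ʳ j)

-- Independent uniformly random orders within the classes amount to a uniformly
-- random order among those compatible with the class assignment.
ieRevenue : ∀ {n K} → DirectedNetwork n → ProbabilityVector K → Vector ℝ K → ℝ
ieRevenue {n} {K} G q p = sumList (List.map term (allAssignments n K))
  where
  term : Vector (Fin K) n → ℝ
  term c = product (prob q ∘ c) *
    mean (List.map (λ π → revenue G π (p ∘ c))
                   (List.filter (compatible? c) (allPermutations n)))

fromℚ-mono-≤ : ∀ {a b} → a ℚ.≤ b → fromℚ a ≤ fromℚ b
fromℚ-mono-≤ {a} {b} a≤b = mk≤ λ ε 0<ε → 0 , λ _ _ →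
  subst (ℚ._≤ b ℚ.+ ε) (ℚ.+-identityʳ a) (ℚ.+-mono-≤ a≤b (ℚ.<⇒≤ 0<ε))

sixClassProbabilities : ProbabilityVector 6
sixClassProbabilities = record
  { prob     = fromℚ ∘ q
  ; 0≤prob   = λ k → fromℚ-mono-≤ (0≤q k)
  ; sum-prob = mk≃ λ ε 0<ε → 0 , λ _ _ → ℚ.<⇒≤ 0<ε
  }
  where
  q : Vector ℚ 6
  q zero                               = + 183 ℚ./ 1000
  q (suc zero)                         = + 75 ℚ./ 1000
  q (suc (suc zero))                   = + 75 ℚ./ 1000
  q (suc (suc (suc zero)))             = + 175 ℚ./ 1000
  q (suc (suc (suc (suc zero))))       = + 261 ℚ./ 1000
  q (suc (suc (suc (suc (suc zero))))) = + 231 ℚ./ 1000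
  0≤q : ∀ k → 0ℚ ℚ.≤ q k
  0≤q zero                               = ℚ.nonNegative⁻¹ _
  0≤q (suc zero)                         = ℚ.nonNegative⁻¹ _
  0≤q (suc (suc zero))                   = ℚ.nonNegative⁻¹ _
  0≤q (suc (suc (suc zero)))             = ℚ.nonNegative⁻¹ _
  0≤q (suc (suc (suc (suc zero))))       = ℚ.nonNegative⁻¹ _
  0≤q (suc (suc (suc (suc (suc zero))))) = ℚ.nonNegative⁻¹ _

{-# OPTIONS --safe #-}
module Submission where

-- Both revenues are linear in the weights, so they can be compared edge by edge. For i ≠ j the
-- classes of i and j are independent, and given the classes, j precedes i with probability 1, ½
-- or 0. Hence every edge contributes to the generalized IE strategy the same multiple
--   C = Σ_{a,b} q_a q_b p_a (1 − p_a) p_b Pr[class b precedes class a] = 0.0879031695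
-- of its weight, whereas in any strategy its coefficient p_i (1 − p_i) p_j is at most ¼; and
-- 4C = 0.351612678 > 0.3516. The slack absorbs the errors of comparing reals through the terms
-- of their sequences: eventually each price is at most 1 + η for a fixed η > 0.

open import Algebra.Bundles using (CommutativeRing)
import Algebra.Properties.Semiring.Sum as SemiringSum
open import Data.Bool.Base using (Bool; true; false; _∧_; if_then_else_)
open import Data.Fin.Base as Fin using (Fin; zero; suc; toℕ; punchIn)
import Data.Fin.Properties as Fin
open import Data.Fin.Permutation as Perm
  using (Permutation′; _⟨$⟩ʳ_; _⟨$⟩ˡ_; _≈_; _∘ₚ_; insert; remove; transpose)
import Data.Integer.Base as ℤ
import Data.Integer.Properties as ℤ
open import Data.List.Base as List using (List; []; _∷_)
open import Data.List.Membership.Propositional using (_∈_)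
import Data.List.Membership.Propositional.Properties as ∈
import Data.List.Properties as List
open import Data.List.Relation.Unary.All as All using (All; []; _∷_)
import Data.List.Relation.Unary.All.Properties as All
open import Data.List.Relation.Unary.Any using (here)
open import Data.Nat.Base as ℕ using (ℕ; zero; suc; s≤s; z≤n)
import Data.Nat.Properties as ℕ
open import Data.Product.Base using (∃-syntax; _×_; _,_)
open import Data.Rational.Base as ℚ using (ℚ; 0ℚ; 1ℚ; ½; _/_)
import Data.Rational.Properties as ℚ
open import Data.Rational.Solver using (module +-*-Solver)
open import Data.Rational.Unnormalised.Base as ℚᵘ using (mkℚᵘ; 1ℚᵘ; *≡*)
  renaming (_≃_ to _≃ᵘ_)
import Data.Rational.Unnormalised.Properties as ℚᵘ
open import Data.Sum.Base using (inj₁; inj₂)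
open import Data.Vec.Functional as Vector using (Vector)
open import Function.Base using (_∘_; id; const)
open import Function.Bundles using (_⇔_; mk⇔; Injection)
open import Function.Properties.Inverse using (↔⇒↣)
open import Level using (Level)
open import Relation.Binary.Definitions using (tri<; tri≈; tri>)
open import Relation.Binary.PropositionalEquality
open import Relation.Nullary.Decidable
  using (Dec; yes; no; does; dec-true; dec-false; does-⇔; from-yes; _×-dec_)
open import Relation.Nullary.Negation using (contradiction)
open import Relation.Unary using (Pred; Decidable)

open import Defs using (allAssignments; allPermutations; Compatible; compatible?)

module _ where
  open import Data.Rational.Base using (_+_; _*_; _-_)
  open SemiringSum (CommutativeRing.semiring ℚ.+-*-commutativeRing)
    using (sum; sum-cong-≗; sum-replicate-zero; ∑-distrib-+; ∑-comm; *-distribˡ-sum; *-distribʳ-sum)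
  open ≡-Reasoning

  private variable
    a : Level
    A B C : Set a
    n K : ℕ

  -- Finite sums of rationals over lists.

  sumOver : List A → (A → ℚ) → ℚ
  sumOver []       f = 0ℚ
  sumOver (x ∷ xs) f = f x + sumOver xs f

  infix 5 sumOver
  syntax sumOver xs (λ x → e) = ∑[ x ∈ xs ] e

  +-interchange : ∀ u v x y → (u + v) + (x + y) ≡ (u + x) + (v + y)
  +-interchange = solve 4 (λ u v x y → (u :+ v) :+ (x :+ y) := (u :+ x) :+ (v :+ y)) refl
    where open +-*-Solver

  exchange : ∀ u v x → u * (v * x) ≡ v * (u * x)
  exchange = solve 3 (λ u v x → u :* (v :* x) := v :* (u :* x)) refl
    where open +-*-Solver

  sumOver-cong-All : ∀ {xs : List A} {f g : A → ℚ} →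
    All (λ x → f x ≡ g x) xs → sumOver xs f ≡ sumOver xs g
  sumOver-cong-All []          = refl
  sumOver-cong-All (fx≡gx ∷ h) = cong₂ _+_ fx≡gx (sumOver-cong-All h)

  sumOver-cong : ∀ (xs : List A) {f g : A → ℚ} → (∀ x → f x ≡ g x) → sumOver xs f ≡ sumOver xs g
  sumOver-cong xs f≗g = sumOver-cong-All (All.universal f≗g xs)

  sumOver-zero : ∀ (xs : List A) → sumOver xs (const 0ℚ) ≡ 0ℚ
  sumOver-zero []       = refl
  sumOver-zero (x ∷ xs) = trans (ℚ.+-identityˡ _) (sumOver-zero xs)

  sumOver-+ : ∀ (xs : List A) f g → ∑[ x ∈ xs ] (f x + g x) ≡ sumOver xs f + sumOver xs g
  sumOver-+ []       f g = refl
  sumOver-+ (x ∷ xs) f g = trans (cong ((f x + g x) +_) (sumOver-+ xs f g)) (+-interchange (f x) _ _ _)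

  sumOver-*ˡ : ∀ (xs : List A) k f → ∑[ x ∈ xs ] (k * f x) ≡ k * sumOver xs f
  sumOver-*ˡ []       k f = sym (ℚ.*-zeroʳ k)
  sumOver-*ˡ (x ∷ xs) k f = trans (cong (k * f x +_) (sumOver-*ˡ xs k f)) (sym (ℚ.*-distribˡ-+ k _ _))

  sumOver-*ʳ : ∀ (xs : List A) k f → ∑[ x ∈ xs ] (f x * k) ≡ sumOver xs f * k
  sumOver-*ʳ xs k f = begin
    ∑[ x ∈ xs ] (f x * k) ≡⟨ sumOver-cong xs (λ x → ℚ.*-comm (f x) k) ⟩
    ∑[ x ∈ xs ] (k * f x) ≡⟨ sumOver-*ˡ xs k f ⟩
    k * sumOver xs f      ≡⟨ ℚ.*-comm k _ ⟩
    sumOver xs f * k      ∎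

  sumOver-sum : ∀ (xs : List A) (f : A → Vector ℚ n) →
                ∑[ x ∈ xs ] sum (f x) ≡ sum λ i → ∑[ x ∈ xs ] f x i
  sumOver-sum {n = n} [] f = sym (sum-replicate-zero n)
  sumOver-sum (x ∷ xs)   f = trans (cong (sum (f x) +_) (sumOver-sum xs f)) (sym (∑-distrib-+ (f x) _))

  sumOver-comm : ∀ (xs : List A) (ys : List B) (f : A → B → ℚ) →
                 ∑[ x ∈ xs ] ∑[ y ∈ ys ] f x y ≡ ∑[ y ∈ ys ] ∑[ x ∈ xs ] f x y
  sumOver-comm []       ys f = sym (sumOver-zero ys)
  sumOver-comm (x ∷ xs) ys f =
    trans (cong (sumOver ys (f x) +_) (sumOver-comm xs ys f)) (sym (sumOver-+ ys (f x) _))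

  sumOver-++ : ∀ (xs ys : List A) f → sumOver (xs List.++ ys) f ≡ sumOver xs f + sumOver ys f
  sumOver-++ []       ys f = sym (ℚ.+-identityˡ _)
  sumOver-++ (x ∷ xs) ys f = trans (cong (f x +_) (sumOver-++ xs ys f)) (sym (ℚ.+-assoc (f x) _ _))

  sumOver-map : ∀ (h : A → B) xs f → sumOver (List.map h xs) f ≡ sumOver xs (f ∘ h)
  sumOver-map h []       f = refl
  sumOver-map h (x ∷ xs) f = cong (f (h x) +_) (sumOver-map h xs f)

  sumOver-cartesianProductWith : ∀ (h : A → B → C) xs ys f →
    sumOver (List.cartesianProductWith h xs ys) f ≡ ∑[ x ∈ xs ] ∑[ y ∈ ys ] f (h x y)
  sumOver-cartesianProductWith h []       ys f = refl
  sumOver-cartesianProductWith h (x ∷ xs) ys f = trans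
    (sumOver-++ (List.map (h x) ys) _ f)
    (cong₂ _+_ (sumOver-map (h x) ys f) (sumOver-cartesianProductWith h xs ys f))

  sumOver-tabulate : ∀ (g : Vector A n) f → sumOver (List.tabulate g) f ≡ sum (f ∘ g)
  sumOver-tabulate {n = zero}  g f = refl
  sumOver-tabulate {n = suc n} g f = cong (f (g zero) +_) (sumOver-tabulate (g ∘ suc) f)

  𝟙 : Bool → ℚ
  𝟙 b = if b then 1ℚ else 0ℚ

  -- With the filter turned into an indicator factor, a sum over the compatible permutations becomes
  -- a sum over all permutations, which can be reindexed.
  sumOver-filter : ∀ {p} {P : Pred A p} (P? : Decidable P) xs f →
    sumOver (List.filter P? xs) f ≡ ∑[ x ∈ xs ] (𝟙 (does (P? x)) * f x)
  sumOver-filter P? []       f = refl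
  sumOver-filter P? (x ∷ xs) f with does (P? x)
  ... | true  = cong₂ _+_ (sym (ℚ.*-identityˡ (f x))) (sumOver-filter P? xs f)
  ... | false = begin
    sumOver (List.filter P? xs) f
      ≡⟨ trans (sumOver-filter P? xs f) (sym (ℚ.+-identityˡ _)) ⟩
    0ℚ + (∑[ y ∈ xs ] (𝟙 (does (P? y)) * f y))
      ≡⟨ cong (_+ (∑[ y ∈ xs ] (𝟙 (does (P? y)) * f y))) (ℚ.*-zeroˡ (f x)) ⟨
    0ℚ * f x + (∑[ y ∈ xs ] (𝟙 (does (P? y)) * f y)) ∎

  sum-𝟙 : ∀ (j : Fin n) → sum (λ i → 𝟙 (does (i Fin.≟ j))) ≡ 1ℚ
  sum-𝟙 {suc n} zero    = trans (cong (1ℚ +_) (sum-replicate-zero n)) (ℚ.+-identityʳ 1ℚ)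
  sum-𝟙 {suc n} (suc j) = trans (ℚ.+-identityˡ _) (sum-𝟙 j)

  -- Enumeration of the permutations and reindexing of sums over them.

  infix 4 _≈?_
  _≈?_ : ∀ (π ρ : Permutation′ n) → Dec (π ≈ ρ)
  π ≈? ρ = Fin.all? λ i → (π ⟨$⟩ʳ i) Fin.≟ (ρ ⟨$⟩ʳ i)

  𝟙-∧ : ∀ x y → 𝟙 (x ∧ y) ≡ 𝟙 x * 𝟙 y
  𝟙-∧ true  y = sym (ℚ.*-identityˡ (𝟙 y))
  𝟙-∧ false y = sym (ℚ.*-zeroˡ (𝟙 y))

  𝟙-cong-* : ∀ {P : Set} (P? : Dec P) {x y} →
    (P → x ≡ y) → 𝟙 (does P?) * x ≡ 𝟙 (does P?) * y
  𝟙-cong-* (yes p) eq         = cong (1ℚ *_) (eq p)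
  𝟙-cong-* (no _)  {x} {y} eq = trans (ℚ.*-zeroˡ x) (sym (ℚ.*-zeroˡ y))

  -- A permutation is determined by the image of `zero` and by what remains after its removal, and
  -- `punchIn k` is injective, so the two data can be matched separately. The product form lets the
  -- counting sum factor.
  insert-≈? : ∀ k (π : Permutation′ n) (σ : Permutation′ (suc n)) →
    𝟙 (does (insert zero k π ≈? σ)) ≡
    𝟙 (does (k Fin.≟ (σ ⟨$⟩ʳ zero))) * 𝟙 (does (π ≈? remove zero σ))
  insert-≈? k π σ = trans
    (cong 𝟙 (does-⇔ (mk⇔ to from)
      (insert zero k π ≈? σ) ((k Fin.≟ (σ ⟨$⟩ʳ zero)) ×-dec (π ≈? remove zero σ))))
    (𝟙-∧ (does (k Fin.≟ (σ ⟨$⟩ʳ zero))) (does (π ≈? remove zero σ)))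
    where
    to : insert zero k π ≈ σ → k ≡ σ ⟨$⟩ʳ zero × π ≈ remove zero σ
    to eq = eq zero , λ i → Fin.punchIn-injective k _ _ (begin
      punchIn k (π ⟨$⟩ʳ i)                           ≡⟨ eq (suc i) ⟩
      σ ⟨$⟩ʳ suc i                                   ≡⟨ Perm.punchIn-permute σ zero i ⟩
      punchIn (σ ⟨$⟩ʳ zero) (remove zero σ ⟨$⟩ʳ i)   ≡⟨ cong (λ l → punchIn l (remove zero σ ⟨$⟩ʳ i)) (eq zero) ⟨
      punchIn k (remove zero σ ⟨$⟩ʳ i)               ∎)
    from : k ≡ σ ⟨$⟩ʳ zero × π ≈ remove zero σ → insert zero k π ≈ σ
    from (k≡ , eq) zero    = k≡
    from (k≡ , eq) (suc i) = trans (cong₂ punchIn k≡ (eq i)) (sym (Perm.punchIn-permute σ zero i))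

  -- By induction: the sum factors into the count of positions equal to that of buyer `zero` and the
  -- count of permutations matching the rest, and both counts are 1.
  allPermutations-exactlyOnce : ∀ n (σ : Permutation′ n) →
    ∑[ π ∈ allPermutations n ] 𝟙 (does (π ≈? σ)) ≡ 1ℚ
  allPermutations-exactlyOnce zero    σ = refl
  allPermutations-exactlyOnce (suc n) σ = begin
    ∑[ π ∈ allPermutations (suc n) ] 𝟙 (does (π ≈? σ))
      ≡⟨ sumOver-cartesianProductWith (insert zero) (List.allFin (suc n)) (allPermutations n) _ ⟩
    ∑[ k ∈ List.allFin (suc n) ] ∑[ π ∈ allPermutations n ] 𝟙 (does (insert zero k π ≈? σ))
      ≡⟨ sumOver-cong (List.allFin (suc n)) (λ k → trans
           (sumOver-cong (allPermutations n) (λ π → insert-≈? k π σ))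
           (sumOver-*ˡ (allPermutations n) (𝟙 (does (k Fin.≟ σ₀))) _)) ⟩
    ∑[ k ∈ List.allFin (suc n) ] (𝟙 (does (k Fin.≟ σ₀)) *
      (∑[ π ∈ allPermutations n ] 𝟙 (does (π ≈? remove zero σ))))
      ≡⟨ sumOver-*ʳ (List.allFin (suc n)) _ (λ k → 𝟙 (does (k Fin.≟ σ₀))) ⟩
    (∑[ k ∈ List.allFin (suc n) ] 𝟙 (does (k Fin.≟ σ₀))) *
      (∑[ π ∈ allPermutations n ] 𝟙 (does (π ≈? remove zero σ)))
      ≡⟨ cong₂ _*_
           (trans (sumOver-tabulate id (λ k → 𝟙 (does (k Fin.≟ σ₀)))) (sum-𝟙 σ₀))
           (allPermutations-exactlyOnce n (remove zero σ)) ⟩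
    1ℚ * 1ℚ
      ∎
    where σ₀ = σ ⟨$⟩ʳ zero

  -- The enumeration is complete only up to pointwise equality, so a summand must be invariant under
  -- `_≈_` before its sum can be reindexed.
  RespectsPerm : (Permutation′ n → ℚ) → Set
  RespectsPerm f = ∀ π ρ → π ≈ ρ → f π ≡ f ρ

  sum-𝟙-≈ : ∀ (f : Permutation′ n → ℚ) → RespectsPerm f → ∀ σ →
    ∑[ π ∈ allPermutations n ] (𝟙 (does (π ≈? σ)) * f π) ≡ f σ
  sum-𝟙-≈ {n} f resp σ = begin
    ∑[ π ∈ allPermutations n ] (𝟙 (does (π ≈? σ)) * f π) ≡⟨ sumOver-cong (allPermutations n) eq ⟩
    ∑[ π ∈ allPermutations n ] (𝟙 (does (π ≈? σ)) * f σ) ≡⟨ sumOver-*ʳ (allPermutations n) (f σ) _ ⟩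
    (∑[ π ∈ allPermutations n ] 𝟙 (does (π ≈? σ))) * f σ ≡⟨ cong (_* f σ) (allPermutations-exactlyOnce n σ) ⟩
    1ℚ * f σ                                             ≡⟨ ℚ.*-identityˡ (f σ) ⟩
    f σ                                                  ∎
    where
    eq : ∀ π → 𝟙 (does (π ≈? σ)) * f π ≡ 𝟙 (does (π ≈? σ)) * f σ
    eq π = 𝟙-cong-* (π ≈? σ) (resp π σ)

  -- Write f ρ as a sum over the one π in the list with π ≈ flip τ ∘ₚ ρ, and exchange the sums.
  sum-∘ₚ : ∀ (τ : Permutation′ n) f → RespectsPerm f →
    sumOver (allPermutations n) f ≡ ∑[ π ∈ allPermutations n ] f (τ ∘ₚ π)
  sum-∘ₚ {n} τ f resp = begin
    sumOver P f
      ≡⟨ sumOver-cong P (λ ρ → ℚ.*-identityˡ (f ρ)) ⟨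
    ∑[ ρ ∈ P ] (1ℚ * f ρ)
      ≡⟨ sumOver-cong P (λ ρ → cong (_* f ρ)
           (allPermutations-exactlyOnce n (Perm.flip τ ∘ₚ ρ))) ⟨
    ∑[ ρ ∈ P ] ((∑[ π ∈ P ] 𝟙 (does (π ≈? Perm.flip τ ∘ₚ ρ))) * f ρ)
      ≡⟨ sumOver-cong P (λ ρ → trans (cong (_* f ρ) (sumOver-cong P (λ π →
           cong 𝟙 (does-⇔ (mk⇔ (to π ρ) (from π ρ)) (π ≈? Perm.flip τ ∘ₚ ρ) (ρ ≈? τ ∘ₚ π)))))
           (sym (sumOver-*ʳ P (f ρ) _))) ⟩
    ∑[ ρ ∈ P ] ∑[ π ∈ P ] (𝟙 (does (ρ ≈? τ ∘ₚ π)) * f ρ)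
      ≡⟨ sumOver-comm P P _ ⟩
    ∑[ π ∈ P ] ∑[ ρ ∈ P ] (𝟙 (does (ρ ≈? τ ∘ₚ π)) * f ρ)
      ≡⟨ sumOver-cong P (λ π → sum-𝟙-≈ f resp (τ ∘ₚ π)) ⟩
    ∑[ π ∈ P ] f (τ ∘ₚ π)
      ∎
    where
    P = allPermutations n
    to : ∀ π ρ → π ≈ Perm.flip τ ∘ₚ ρ → ρ ≈ τ ∘ₚ π
    to π ρ eq i = sym (trans (eq (τ ⟨$⟩ʳ i)) (cong (ρ ⟨$⟩ʳ_) (Perm.inverseˡ τ)))
    from : ∀ π ρ → ρ ≈ τ ∘ₚ π → π ≈ Perm.flip τ ∘ₚ ρ
    from π ρ eq i = sym (trans (eq (τ ⟨$⟩ˡ i)) (cong (π ⟨$⟩ʳ_) (Perm.inverseʳ τ)))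

  -- Existence of an order compatible with a class assignment.

  <-punchIn : ∀ (k : Fin (suc n)) m → toℕ k ℕ.≤ toℕ m → k Fin.< punchIn k m
  <-punchIn zero    m       k≤m       = s≤s z≤n
  <-punchIn (suc k) (suc m) (s≤s k≤m) = s≤s (<-punchIn k m k≤m)

  punchIn-< : ∀ (k : Fin (suc n)) m → toℕ m ℕ.< toℕ k → punchIn k m Fin.< k
  punchIn-< (suc k) zero    m<k       = s≤s z≤n
  punchIn-< (suc k) (suc m) (s≤s m<k) = s≤s (punchIn-< k m m<k)

  punchIn-mono-< : ∀ k {l m : Fin n} → l Fin.< m → punchIn k l Fin.< punchIn k m
  punchIn-mono-< k l<m = ℕ.≰⇒> λ m≤l → ℕ.<⇒≱ l<m (Fin.punchIn-cancel-≤ k _ _ m≤l)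

  -- The number of positions whose class precedes x: there a new buyer of class x can be inserted.
  threshold : ∀ (d : Vector (Fin K) n) → (∀ {l m} → l Fin.≤ m → d l Fin.≤ d m) → ∀ (x : Fin K) →
    ∃[ k ] (∀ m → d m Fin.< x → toℕ m ℕ.< toℕ {suc n} k) × (∀ m → x Fin.< d m → toℕ k ℕ.≤ toℕ m)
  threshold {n = zero}  d mono x = zero , (λ ()) , λ ()
  threshold {n = suc n} d mono x with d zero Fin.<? x
  ... | no d₀≮x =
    zero , (λ m dₘ<x → contradiction (ℕ.≤-<-trans (mono z≤n) dₘ<x) d₀≮x) , λ _ _ → z≤n
  ... | yes d₀<x =
    let (k , below , above) = threshold (d ∘ suc) (mono ∘ s≤s) x
    in suc k
     , (λ { zero _ → s≤s z≤n ; (suc m) dₘ<x → s≤s (below m dₘ<x) })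
     , (λ { zero x<d₀ → contradiction x<d₀ (ℕ.<-asym d₀<x) ; (suc m) x<dₘ → s≤s (above m x<dₘ) })

  -- Insertion sort: the buyers other than `zero` are ordered first, then `zero` is inserted at the
  -- threshold of its class. Membership in `allPermutations` is recorded to show that the filtered
  -- list is nonempty.
  compatible-exists : ∀ n (c : Vector (Fin K) n) →
    ∃[ π ] π ∈ allPermutations n × Compatible c π
  compatible-exists zero    c = Perm.id , here refl , λ ()
  compatible-exists (suc n) c =
    let (π , π∈ , compat)   = compatible-exists n (c ∘ suc)
        (k , below , above) = threshold (c ∘ suc ∘ (π ⟨$⟩ˡ_)) (mono π compat) (c zero)
    in insert zero k π
     , ∈.∈-cartesianProductWith⁺ (insert zero) (∈.∈-allFin k) π∈
     , λ { zero    zero    c<c → contradiction c<c (ℕ.<-irrefl refl)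
         ; zero    (suc j) c<c → <-punchIn k _
             (above _ (subst (λ i → c zero Fin.< c (suc i)) (sym (Perm.inverseˡ π)) c<c))
         ; (suc i) zero    c<c → punchIn-< k _
             (below _ (subst (λ i → c (suc i) Fin.< c zero) (sym (Perm.inverseˡ π)) c<c))
         ; (suc i) (suc j) c<c → punchIn-mono-< k (compat i j c<c) }
    where
    mono : ∀ π → Compatible (c ∘ suc) π → ∀ {l m} → l Fin.≤ m →
           c (suc (π ⟨$⟩ˡ l)) Fin.≤ c (suc (π ⟨$⟩ˡ m))
    mono π compat l≤m = ℕ.≮⇒≥ λ cm<cl → ℕ.<⇒≱
      (subst₂ Fin._<_ (Perm.inverseʳ π) (Perm.inverseʳ π) (compat _ _ cm<cl)) l≤m

  -- Means of rationals over lists.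

  -- The value at the empty list agrees with the dummy value of `mean`, so `seq-mean` holds for
  -- every list.
  meanOver : List A → (A → ℚ) → ℚ
  meanOver []          f = 0ℚ
  meanOver xs@(_ ∷ _) f = (ℤ.+ 1 / List.length xs) * sumOver xs f

  -- Stated through the sums, so that it also applies to functions that agree only on the listed
  -- elements or only after a reindexing.
  meanOver-cong-sumOver : ∀ (xs : List A) {f g : A → ℚ} →
    sumOver xs f ≡ sumOver xs g → meanOver xs f ≡ meanOver xs g
  meanOver-cong-sumOver []          eq = refl
  meanOver-cong-sumOver xs@(_ ∷ _) eq = cong ((ℤ.+ 1 / List.length xs) *_) eq

  meanOver-cong : ∀ (xs : List A) {f g : A → ℚ} → (∀ x → f x ≡ g x) → meanOver xs f ≡ meanOver xs g
  meanOver-cong xs f≗g = meanOver-cong-sumOver xs (sumOver-cong xs f≗g)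

  meanOver-+ : ∀ (xs : List A) f g → meanOver xs (λ x → f x + g x) ≡ meanOver xs f + meanOver xs g
  meanOver-+ []          f g = refl
  meanOver-+ xs@(_ ∷ _) f g =
    trans (cong ((ℤ.+ 1 / List.length xs) *_) (sumOver-+ xs f g))
    (ℚ.*-distribˡ-+ (ℤ.+ 1 / List.length xs) _ _)

  meanOver-zero : ∀ (xs : List A) → meanOver xs (const 0ℚ) ≡ 0ℚ
  meanOver-zero []          = refl
  meanOver-zero xs@(_ ∷ _) =
    trans (cong ((ℤ.+ 1 / List.length xs) *_) (sumOver-zero xs))
    (ℚ.*-zeroʳ (ℤ.+ 1 / List.length xs))

  meanOver-*ˡ : ∀ (xs : List A) k f → meanOver xs (λ x → k * f x) ≡ k * meanOver xs f
  meanOver-*ˡ []          k f = sym (ℚ.*-zeroʳ k)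
  meanOver-*ˡ xs@(_ ∷ _) k f =
    trans (cong ((ℤ.+ 1 / List.length xs) *_) (sumOver-*ˡ xs k f))
    (exchange (ℤ.+ 1 / List.length xs) k _)

  meanOver-sum : ∀ (xs : List A) (f : A → Vector ℚ n) →
    meanOver xs (λ x → sum (f x)) ≡ sum λ i → meanOver xs (λ x → f x i)
  meanOver-sum {n = n} [] f = sym (sum-replicate-zero n)
  meanOver-sum {n = n} xs@(_ ∷ _) f =
    trans (cong ((ℤ.+ 1 / List.length xs) *_) (sumOver-sum xs f))
    (*-distribˡ-sum {n} (ℤ.+ 1 / List.length xs) (λ i → sumOver xs (λ x → f x i)))

  -- The quotient is normalised by a gcd, which does not compute for a variable `m`; the next two
  -- identities are therefore checked on unnormalised fractions.
  toℚᵘ-/ : ∀ i m → ℚ.toℚᵘ (i / suc m) ≃ᵘ mkℚᵘ i m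
  toℚᵘ-/ i m = ℚ.toℚᵘ-fromℚᵘ (mkℚᵘ i m)

  1+m/1 : ∀ m → 1ℚ + (ℤ.+ m / 1) ≡ ℤ.+ suc m / 1
  1+m/1 m = ℚ.toℚᵘ-injective (begin-≃
    ℚ.toℚᵘ (1ℚ + (ℤ.+ m / 1))          ≈⟨ ℚ.toℚᵘ-homo-+ 1ℚ (ℤ.+ m / 1) ⟩
    1ℚᵘ ℚᵘ.+ ℚ.toℚᵘ (ℤ.+ m / 1)        ≈⟨ ℚᵘ.+-congʳ 1ℚᵘ (toℚᵘ-/ (ℤ.+ m) 0) ⟩
    1ℚᵘ ℚᵘ.+ mkℚᵘ (ℤ.+ m) 0
      ≈⟨ *≡* (cong (λ i → (ℤ.1ℤ ℤ.+ i) ℤ.* ℤ.1ℤ) (ℤ.*-identityʳ (ℤ.+ m))) ⟩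
    mkℚᵘ (ℤ.+ suc m) 0                 ≈⟨ toℚᵘ-/ (ℤ.+ suc m) 0 ⟨
    ℚ.toℚᵘ (ℤ.+ suc m / 1)             ∎-≃)
    where open ℚᵘ.≃-Reasoning renaming (begin_ to begin-≃_; _∎ to _∎-≃)

  1/m*m/1 : ∀ m → (ℤ.+ 1 / suc m) * (ℤ.+ suc m / 1) ≡ 1ℚ
  1/m*m/1 m = ℚ.toℚᵘ-injective (begin-≃
    ℚ.toℚᵘ ((ℤ.+ 1 / suc m) * (ℤ.+ suc m / 1))
      ≈⟨ ℚ.toℚᵘ-homo-* (ℤ.+ 1 / suc m) (ℤ.+ suc m / 1) ⟩
    ℚ.toℚᵘ (ℤ.+ 1 / suc m) ℚᵘ.* ℚ.toℚᵘ (ℤ.+ suc m / 1)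
      ≈⟨ ℚᵘ.*-cong (toℚᵘ-/ (ℤ.+ 1) m) (toℚᵘ-/ (ℤ.+ suc m) 0) ⟩
    mkℚᵘ (ℤ.+ 1) m ℚᵘ.* mkℚᵘ (ℤ.+ suc m) 0
      ≈⟨ *≡* (trans (ℤ.*-identityʳ _)
           (cong (λ i → ℤ.1ℤ ℤ.* i) (sym (ℤ.*-identityʳ (ℤ.+ suc m))))) ⟩
    1ℚᵘ                                                 ∎-≃)
    where open ℚᵘ.≃-Reasoning renaming (begin_ to begin-≃_; _∎ to _∎-≃)

  sumOver-one : ∀ (xs : List A) → sumOver xs (const 1ℚ) ≡ ℤ.+ List.length xs / 1
  sumOver-one []       = refl
  sumOver-one (x ∷ xs) = trans (cong (1ℚ +_) (sumOver-one xs)) (1+m/1 (List.length xs))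

  meanOver-one : ∀ {xs : List A} {x} → x ∈ xs → meanOver xs (const 1ℚ) ≡ 1ℚ
  meanOver-one {xs = xs@(_ ∷ ys)} _ =
    trans (cong ((ℤ.+ 1 / List.length xs) *_) (sumOver-one xs)) (1/m*m/1 (List.length ys))

  -- Order of two buyers in a uniformly random compatible permutation.

  transpose-ˡ : ∀ (i j : Fin n) → transpose i j ⟨$⟩ʳ i ≡ j
  transpose-ˡ i j rewrite dec-true (i Fin.≟ i) refl = refl

  transpose-ʳ : ∀ (i j : Fin n) → transpose i j ⟨$⟩ʳ j ≡ i
  transpose-ʳ i j with j Fin.≟ i
  ... | yes j≡i = j≡i
  ... | no  _ rewrite dec-true (j Fin.≟ j) refl = refl

  -- The probability, given the classes, that a buyer of class `a` is approached before a different
  -- buyer of class `b`; `mean-before` justifies the values.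
  precedence : Fin K → Fin K → ℚ
  precedence a b = if does (a Fin.<? b) then 1ℚ else if does (a Fin.≟ b) then ½ else 0ℚ

  before : Permutation′ n → Fin n → Fin n → ℚ
  before π j i = 𝟙 (does (π ⟨$⟩ʳ j Fin.<? π ⟨$⟩ʳ i))

  before-resp : ∀ (j i : Fin n) → RespectsPerm (λ π → before π j i)
  before-resp j i π ρ eq = cong₂ (λ k l → 𝟙 (does (k Fin.<? l))) (eq j) (eq i)

  before-true : ∀ (π : Permutation′ n) {i j} → π ⟨$⟩ʳ j Fin.< π ⟨$⟩ʳ i → before π j i ≡ 1ℚ
  before-true π lt = cong 𝟙 (dec-true (_ Fin.<? _) lt)

  before-false : ∀ (π : Permutation′ n) {i j} → π ⟨$⟩ʳ i Fin.≤ π ⟨$⟩ʳ j → before π j i ≡ 0ℚ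
  before-false π le = cong 𝟙 (dec-false (_ Fin.<? _) (ℕ.≤⇒≯ le))

  before-total : ∀ (π : Permutation′ n) {i j} → i ≢ j → before π j i + before π i j ≡ 1ℚ
  before-total π {i} {j} i≢j with Fin.<-cmp (π ⟨$⟩ʳ j) (π ⟨$⟩ʳ i)
  ... | tri< lt _ _ = cong₂ _+_ (before-true π lt) (before-false π (ℕ.<⇒≤ lt))
  ... | tri≈ _ eq _ = contradiction (sym (Injection.injective (↔⇒↣ π) eq)) i≢j
  ... | tri> _ _ gt = cong₂ _+_ (before-false π (ℕ.<⇒≤ gt)) (before-true π gt)

  module _ (c : Vector (Fin K) n) where
    compatibles : List (Permutation′ n)
    compatibles = List.filter (compatible? c) (allPermutations n)

    class-transpose : ∀ {i j} → c i ≡ c j → ∀ k → c (transpose i j ⟨$⟩ʳ k) ≡ c k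
    class-transpose {i} {j} ci≡cj k with k Fin.≟ i
    ... | yes refl = sym ci≡cj
    ... | no  _ with k Fin.≟ j
    ...   | yes refl = ci≡cj
    ...   | no  _    = refl

    Compatible-resp : ∀ {π ρ} → π ≈ ρ → Compatible c π → Compatible c ρ
    Compatible-resp eq compat i j ci<cj = subst₂ Fin._<_ (eq i) (eq j) (compat i j ci<cj)

    -- Compatibility sees buyers only through their classes, which `τ` preserves. The converse
    -- direction uses that the inverse of `τ` then preserves them too.
    Compatible-∘ₚ : ∀ {τ : Permutation′ n} → (∀ k → c (τ ⟨$⟩ʳ k) ≡ c k) → ∀ π →
      Compatible c π ⇔ Compatible c (τ ∘ₚ π)
    Compatible-∘ₚ {τ} eq π = mk⇔ to from
      where
      to : Compatible c π → Compatible c (τ ∘ₚ π)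
      to compat a b ca<cb = compat _ _ (subst₂ Fin._<_ (sym (eq a)) (sym (eq b)) ca<cb)
      eq⁻ : ∀ k → c k ≡ c (τ ⟨$⟩ˡ k)
      eq⁻ k = trans (cong c (sym (Perm.inverseʳ τ))) (eq (τ ⟨$⟩ˡ k))
      from : Compatible c (τ ∘ₚ π) → Compatible c π
      from compat a b ca<cb = subst₂ (λ a b → π ⟨$⟩ʳ a Fin.< π ⟨$⟩ʳ b)
        (Perm.inverseʳ τ) (Perm.inverseʳ τ)
        (compat (τ ⟨$⟩ˡ a) (τ ⟨$⟩ˡ b) (subst₂ Fin._<_ (eq⁻ a) (eq⁻ b) ca<cb))

    -- Relabelling buyers within their classes permutes the compatible orders: `sum-∘ₚ` is applied
    -- to the indicator of compatibility times `f`, and the indicator is unchanged by `τ`.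
    sum-compatibles-∘ₚ : ∀ {τ : Permutation′ n} → (∀ k → c (τ ⟨$⟩ʳ k) ≡ c k) →
      ∀ f → RespectsPerm f → sumOver compatibles f ≡ ∑[ π ∈ compatibles ] f (τ ∘ₚ π)
    sum-compatibles-∘ₚ {τ} eq f resp = begin
      sumOver compatibles f
        ≡⟨ sumOver-filter (compatible? c) P f ⟩
      ∑[ π ∈ P ] (𝟙 (does (compatible? c π)) * f π)
        ≡⟨ sum-∘ₚ τ _ (λ π ρ π≈ρ → cong₂ _*_
             (cong 𝟙 (does-⇔ (mk⇔ (Compatible-resp {π} {ρ} π≈ρ) (Compatible-resp {ρ} {π} (sym ∘ π≈ρ)))
               (compatible? c π) (compatible? c ρ)))
             (resp π ρ π≈ρ)) ⟩
      ∑[ π ∈ P ] (𝟙 (does (compatible? c (τ ∘ₚ π))) * f (τ ∘ₚ π))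
        ≡⟨ sumOver-cong P (λ π → cong (λ x → 𝟙 x * f (τ ∘ₚ π))
             (does-⇔ (Compatible-∘ₚ {τ} eq π) (compatible? c π) (compatible? c (τ ∘ₚ π)))) ⟨
      ∑[ π ∈ P ] (𝟙 (does (compatible? c π)) * f (τ ∘ₚ π))
        ≡⟨ sumOver-filter (compatible? c) P (λ π → f (τ ∘ₚ π)) ⟨
      ∑[ π ∈ compatibles ] f (τ ∘ₚ π)
        ∎
      where P = allPermutations n

    -- The existence of a compatible order enters here: on an empty list the mean would be 0.
    mean-one : meanOver compatibles (const 1ℚ) ≡ 1ℚ
    mean-one = let (_ , π∈ , compat) = compatible-exists n c in
      meanOver-one (∈.∈-filter⁺ (compatible? c) π∈ compat)

    all-compatible : All (Compatible c) compatibles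
    all-compatible = All.all-filter (compatible? c) (allPermutations n)

    -- Within a class, transposing i and j shows that both orders have the same mean, hence ½.
    mean-before : ∀ {i j} → i ≢ j →
      meanOver compatibles (λ π → before π j i) ≡ precedence (c j) (c i)
    mean-before {i} {j} i≢j with Fin.<-cmp (c j) (c i)
    ... | tri< lt _ _ = trans
      (meanOver-cong-sumOver compatibles
        (sumOver-cong-All (All.map (λ {π} compat → before-true π (compat j i lt)) all-compatible)))
      (trans mean-one (sym eq))
      where
      eq : precedence (c j) (c i) ≡ 1ℚ
      eq rewrite dec-true (c j Fin.<? c i) lt = refl
    ... | tri> ≮ ≢ gt = trans
      (meanOver-cong-sumOver compatibles
        (sumOver-cong-All
          (All.map (λ {π} compat → before-false π (ℕ.<⇒≤ (compat i j gt))) all-compatible)))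
      (trans (meanOver-zero compatibles) (sym eq))
      where
      eq : precedence (c j) (c i) ≡ 0ℚ
      eq rewrite dec-false (c j Fin.<? c i) ≮ | dec-false (c j Fin.≟ c i) ≢ = refl
    ... | tri≈ ≮ cj≡ci _ = begin
      M j i                         ≡⟨ double (M j i) ⟩
      ½ * (M j i + M j i)           ≡⟨ cong (λ x → ½ * (M j i + x)) symmetric ⟩
      ½ * (M j i + M i j)           ≡⟨ cong (½ *_) (meanOver-+ compatibles _ _) ⟨
      ½ * meanOver compatibles (λ π → before π j i + before π i j)
        ≡⟨ cong (½ *_) (trans (meanOver-cong compatibles (λ π → before-total π i≢j)) mean-one) ⟩
      ½ * 1ℚ                        ≡⟨ eq ⟨
      precedence (c j) (c i)        ∎
      where
      M : Fin n → Fin n → ℚ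
      M j i = meanOver compatibles (λ π → before π j i)
      double : ∀ x → x ≡ ½ * (x + x)
      double = solve 1 (λ x → x := con ½ :* (x :+ x)) refl
        where open +-*-Solver
      symmetric : M j i ≡ M i j
      symmetric = meanOver-cong-sumOver compatibles (trans
        (sum-compatibles-∘ₚ {transpose i j} (class-transpose (sym cj≡ci))
          (λ π → before π j i) (before-resp j i))
        (sumOver-cong compatibles (λ π → cong₂ (before π) (transpose-ʳ i j) (transpose-ˡ i j))))
      eq : precedence (c j) (c i) ≡ ½ * 1ℚ
      eq rewrite dec-false (c j Fin.<? c i) ≮ | dec-true (c j Fin.≟ c i) cj≡ci = refl

  -- Expectations over independent class assignments.

  ∏ : Vector ℚ n → ℚ
  ∏ = Vector.foldr _*_ 1ℚ

  module Assignments (q : Vector ℚ K) (∑q≡1 : sum q ≡ 1ℚ) where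

    𝔼 : (Vector (Fin K) n → ℚ) → ℚ
    𝔼 {n} f = ∑[ c ∈ allAssignments n K ] (∏ (q ∘ c) * f c)

    𝔼₁ : Vector ℚ K → ℚ
    𝔼₁ g = sum λ a → q a * g a

    𝔼₂ : (Fin K → Fin K → ℚ) → ℚ
    𝔼₂ g = 𝔼₁ λ a → 𝔼₁ (g a)

    -- Fubini for the product law: the class of buyer `zero` is enumerated first, and its weight
    -- `q a` comes out of the inner sum.
    𝔼-suc : ∀ (f : Vector (Fin K) (suc n) → ℚ) → 𝔼 f ≡ 𝔼₁ λ a → 𝔼 λ c → f (a Vector.∷ c)
    𝔼-suc {n} f = begin
      𝔼 f
        ≡⟨ sumOver-cartesianProductWith Vector._∷_ (List.allFin K) (allAssignments n K) _ ⟩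
      ∑[ a ∈ List.allFin K ] ∑[ c ∈ allAssignments n K ] ((q a * ∏ (q ∘ c)) * f (a Vector.∷ c))
        ≡⟨ sumOver-cong (List.allFin K) (λ a → trans
             (sumOver-cong (allAssignments n K) (λ c → ℚ.*-assoc (q a) _ _))
             (sumOver-*ˡ (allAssignments n K) (q a) _)) ⟩
      ∑[ a ∈ List.allFin K ] (q a * 𝔼 (λ c → f (a Vector.∷ c)))
        ≡⟨ sumOver-tabulate {n = K} id (λ a → q a * 𝔼 (λ c → f (a Vector.∷ c))) ⟩
      𝔼₁ (λ a → 𝔼 λ c → f (a Vector.∷ c))
        ∎

    𝔼₁-cong : ∀ {g h} → (∀ a → g a ≡ h a) → 𝔼₁ g ≡ 𝔼₁ h
    𝔼₁-cong eq = sum-cong-≗ (λ a → cong (q a *_) (eq a))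

    𝔼₁-const : ∀ k → 𝔼₁ (const k) ≡ k
    𝔼₁-const k = trans (sym (*-distribʳ-sum k q)) (trans (cong (_* k) ∑q≡1) (ℚ.*-identityˡ k))

    -- `𝔼-suc` exposes the classes in index order; this exchange handles a pair given in the
    -- opposite order.
    𝔼₁-comm : ∀ g → 𝔼₂ g ≡ 𝔼₁ λ b → 𝔼₁ λ a → g a b
    𝔼₁-comm g = begin
      (sum λ a → q a * sum λ b → q b * g a b)    ≡⟨ sum-cong-≗ (λ a → *-distribˡ-sum (q a) (λ b → q b * g a b)) ⟩
      (sum λ a → sum λ b → q a * (q b * g a b))  ≡⟨ ∑-comm (λ a b → q a * (q b * g a b)) ⟩
      (sum λ b → sum λ a → q a * (q b * g a b))
        ≡⟨ sum-cong-≗ (λ b → sum-cong-≗ (λ a → exchange (q a) (q b) (g a b))) ⟩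
      (sum λ b → sum λ a → q b * (q a * g a b))  ≡⟨ sum-cong-≗ (λ b → *-distribˡ-sum (q b) (λ a → q a * g a b)) ⟨
      (sum λ b → q b * sum λ a → q a * g a b)    ∎

    𝔼-const : ∀ k → 𝔼 {n} (const k) ≡ k
    𝔼-const {zero}  k = trans (ℚ.+-identityʳ _) (ℚ.*-identityˡ k)
    𝔼-const {suc n} k = trans (𝔼-suc {n} (const k)) (trans (𝔼₁-cong (λ _ → 𝔼-const {n} k)) (𝔼₁-const k))

    𝔼-marginal : ∀ (i : Fin n) g → 𝔼 (λ c → g (c i)) ≡ 𝔼₁ g
    𝔼-marginal {suc n} zero    g = trans (𝔼-suc _) (𝔼₁-cong (λ a → 𝔼-const {n} (g a)))
    𝔼-marginal {suc n} (suc i) g = trans (𝔼-suc {n} _) (trans (𝔼₁-cong (λ _ → 𝔼-marginal i g)) (𝔼₁-const _))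

    -- Distinct buyers have independent classes: peeling off buyers one at a time, those other than
    -- `i` and `j` integrate out because `q` sums to 1.
    𝔼-marginal₂ : ∀ {i j : Fin n} → i ≢ j → ∀ g → 𝔼 (λ c → g (c i) (c j)) ≡ 𝔼₂ g
    𝔼-marginal₂ {suc n} {zero}  {zero}  i≢j g = contradiction refl i≢j
    𝔼-marginal₂ {suc n} {zero}  {suc j} i≢j g = trans (𝔼-suc {n} _) (𝔼₁-cong (λ a → 𝔼-marginal j (g a)))
    𝔼-marginal₂ {suc n} {suc i} {zero}  i≢j g =
      trans (𝔼-suc {n} _) (trans (𝔼₁-cong (λ b → 𝔼-marginal i (λ a → g a b))) (sym (𝔼₁-comm g)))
    𝔼-marginal₂ {suc n} {suc i} {suc j} i≢j g = trans (𝔼-suc {n} _)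
      (trans (𝔼₁-cong (λ _ → 𝔼-marginal₂ (i≢j ∘ cong suc) g)) (𝔼₁-const _))

    𝔼-cong : ∀ {f g : Vector (Fin K) n → ℚ} → (∀ c → f c ≡ g c) → 𝔼 f ≡ 𝔼 g
    𝔼-cong {n} eq = sumOver-cong (allAssignments n K) (λ c → cong (∏ (q ∘ c) *_) (eq c))

    𝔼-*ˡ : ∀ k (f : Vector (Fin K) n → ℚ) → 𝔼 (λ c → k * f c) ≡ k * 𝔼 f
    𝔼-*ˡ {n} k f = trans
      (sumOver-cong (allAssignments n K) (λ c → exchange (∏ (q ∘ c)) k (f c)))
      (sumOver-*ˡ (allAssignments n K) k _)

    𝔼-sum : ∀ {m} (f : Vector (Fin K) n → Vector ℚ m) →
      𝔼 (λ c → sum (f c)) ≡ sum λ i → 𝔼 (λ c → f c i)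
    𝔼-sum {n} f = trans
      (sumOver-cong (allAssignments n K) (λ c → *-distribˡ-sum (∏ (q ∘ c)) (f c)))
      (sumOver-sum (allAssignments n K) (λ c i → ∏ (q ∘ c) * f c i))

  -- Expected revenue as a linear form in rational weights.

  revenueℚ : (Fin n → Fin n → ℚ) → Permutation′ n → Vector ℚ n → ℚ
  revenueℚ w π p = sum λ i → p i * (1ℚ - p i) *
    sum λ j → if does (π ⟨$⟩ʳ j Fin.<? π ⟨$⟩ʳ i) then p j * w j i else 0ℚ

  -- Isolates the order in the factor `before π j i`, so that for fixed classes the mean over orders
  -- acts on that factor alone.
  revenueℚ-expand : ∀ (w : Fin n → Fin n → ℚ) π p → revenueℚ w π p ≡
    sum λ i → sum λ j → (w j i * (p i * (1ℚ - p i) * p j)) * before π j i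
  revenueℚ-expand w π p = sum-cong-≗ λ i → trans
    (*-distribˡ-sum (p i * (1ℚ - p i))
      (λ j → if does (π ⟨$⟩ʳ j Fin.<? π ⟨$⟩ʳ i) then p j * w j i else 0ℚ))
    (sum-cong-≗ λ j → term (does (π ⟨$⟩ʳ j Fin.<? π ⟨$⟩ʳ i)) (p i * (1ℚ - p i)) (p j) (w j i))
    where
    term : ∀ b x y z → x * (if b then y * z else 0ℚ) ≡ (z * (x * y)) * 𝟙 b
    term true  = solve 3 (λ x y z → x :* (y :* z) := (z :* (x :* y)) :* con 1ℚ) refl
      where open +-*-Solver
    term false = solve 3 (λ x y z → x :* con 0ℚ := (z :* (x :* y)) :* con 0ℚ) refl
      where open +-*-Solver

  module IE (q p : Vector ℚ K) (∑q≡1 : sum q ≡ 1ℚ) where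
    open Assignments q ∑q≡1

    profit : Fin K → Fin K → ℚ
    profit a b = p a * (1ℚ - p a) * p b

    -- The constant C of the overview: `a` is the class of the buyer who pays, `b` that of the buyer
    -- who exerts the influence.
    edgeRevenue : ℚ
    edgeRevenue = 𝔼₂ λ a b → profit a b * precedence b a

    -- The diagonal is 0 because no buyer precedes itself.
    pairRevenue : Fin n → Fin n → ℚ
    pairRevenue i j = if does (i Fin.≟ j) then 0ℚ else edgeRevenue

    ieRevenueℚ : (Fin n → Fin n → ℚ) → ℚ
    ieRevenueℚ w = 𝔼 λ c → meanOver (compatibles c) λ π → revenueℚ w π (p ∘ c)

    mean-revenueℚ : ∀ (w : Fin n → Fin n → ℚ) c →
      meanOver (compatibles c) (λ π → revenueℚ w π (p ∘ c)) ≡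
      sum λ i → sum λ j → (w j i * profit (c i) (c j)) *
        meanOver (compatibles c) (λ π → before π j i)
    mean-revenueℚ w c = begin
      meanOver (compatibles c) (λ π → revenueℚ w π (p ∘ c))
        ≡⟨ meanOver-cong (compatibles c) (λ π → revenueℚ-expand w π (p ∘ c)) ⟩
      meanOver (compatibles c) (λ π → sum λ i → sum λ j → k i j * before π j i)
        ≡⟨ meanOver-sum (compatibles c) (λ π i → sum λ j → k i j * before π j i) ⟩
      (sum λ i → meanOver (compatibles c) (λ π → sum λ j → k i j * before π j i))
        ≡⟨ sum-cong-≗ (λ i → trans
             (meanOver-sum (compatibles c) (λ π j → k i j * before π j i))
             (sum-cong-≗ λ j → meanOver-*ˡ (compatibles c) (k i j) (λ π → before π j i))) ⟩
      (sum λ i → sum λ j → k i j * meanOver (compatibles c) (λ π → before π j i))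
        ∎
      where
      k : Fin _ → Fin _ → ℚ
      k i j = w j i * profit (c i) (c j)

    -- For distinct buyers the mean over orders depends only on their two classes by `mean-before`,
    -- and `𝔼-marginal₂` averages these independently.
    𝔼-pair : ∀ (i j : Fin n) →
      𝔼 (λ c → profit (c i) (c j) * meanOver (compatibles c) (λ π → before π j i)) ≡
      pairRevenue i j
    𝔼-pair {n} i j with i Fin.≟ j
    ... | yes refl = trans (𝔼-cong diagonal) (𝔼-const {n} 0ℚ)
      where
      diagonal : ∀ c → profit (c i) (c i) * meanOver (compatibles c) (λ π → before π i i) ≡ 0ℚ
      diagonal c = trans
        (cong (profit (c i) (c i) *_) (trans
          (meanOver-cong (compatibles c) (λ π → before-false π {i} {i} ℕ.≤-refl))
          (meanOver-zero (compatibles c))))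
        (ℚ.*-zeroʳ (profit (c i) (c i)))
    ... | no i≢j = trans
      (𝔼-cong λ c → cong (profit (c i) (c j) *_) (mean-before c i≢j))
      (𝔼-marginal₂ i≢j (λ a b → profit a b * precedence b a))

    ieRevenueℚ-linear : ∀ (w : Fin n → Fin n → ℚ) →
      ieRevenueℚ w ≡ sum λ i → sum λ j → pairRevenue i j * w j i
    ieRevenueℚ-linear {n} w = begin
      ieRevenueℚ w
        ≡⟨ 𝔼-cong (mean-revenueℚ w) ⟩
      𝔼 (λ c → sum λ i → sum λ j → (w j i * k c i j) * M c i j)
        ≡⟨ 𝔼-sum (λ c i → sum λ j → (w j i * k c i j) * M c i j) ⟩
      (sum λ i → 𝔼 (λ c → sum λ j → (w j i * k c i j) * M c i j))
        ≡⟨ sum-cong-≗ (λ i → 𝔼-sum (λ c j → (w j i * k c i j) * M c i j)) ⟩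
      (sum λ i → sum λ j → 𝔼 (λ c → (w j i * k c i j) * M c i j))
        ≡⟨ sum-cong-≗ (λ i → sum-cong-≗ λ j → trans
             (𝔼-cong λ c → ℚ.*-assoc (w j i) (k c i j) (M c i j))
             (𝔼-*ˡ (w j i) (λ c → k c i j * M c i j))) ⟩
      (sum λ i → sum λ j → w j i * 𝔼 (λ c → k c i j * M c i j))
        ≡⟨ sum-cong-≗ (λ i → sum-cong-≗ λ j → trans
             (cong (w j i *_) (𝔼-pair i j)) (ℚ.*-comm (w j i) (pairRevenue i j))) ⟩
      (sum λ i → sum λ j → pairRevenue i j * w j i)
        ∎
      where
      k M : Vector (Fin K) n → Fin n → Fin n → ℚ
      k c i j = profit (c i) (c j)
      M c i j = meanOver (compatibles c) (λ π → before π j i)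

module _ where

  -- Rational inequalities for a single edge.

  open import Data.Rational.Base using (_+_; _*_; _-_; -_; _≤_)

  0≤-diff : ∀ {p q} → p ≤ q → 0ℚ ≤ q - p
  0≤-diff {p} {q} p≤q = subst (_≤ q - p) (ℚ.+-inverseʳ p) (ℚ.+-monoˡ-≤ (- p) p≤q)

  0≤-+ : ∀ {p q} → 0ℚ ≤ p → 0ℚ ≤ q → 0ℚ ≤ p + q
  0≤-+ 0≤p 0≤q = ℚ.+-mono-≤ 0≤p 0≤q

  0≤-* : ∀ {p q} → 0ℚ ≤ p → 0ℚ ≤ q → 0ℚ ≤ p * q
  0≤-* {p} {q} 0≤p 0≤q = ℚ.nonNegative⁻¹ (p * q)
    {{ℚ.nonNeg*nonNeg⇒nonNeg p {{ℚ.nonNegative 0≤p}} q {{ℚ.nonNegative 0≤q}}}}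

  0≤-sq : ∀ p → 0ℚ ≤ p * p
  0≤-sq p with ℚ.≤-total 0ℚ p
  ... | inj₁ 0≤p = 0≤-* 0≤p 0≤p
  ... | inj₂ p≤0 = subst (0ℚ ≤_) (neg-sq p) (0≤-* (ℚ.neg-antimono-≤ p≤0) (ℚ.neg-antimono-≤ p≤0))
    where
    neg-sq : ∀ p → (- p) * (- p) ≡ p * p
    neg-sq = solve 1 (λ p → (:- p) :* (:- p) := p :* p) refl
      where open +-*-Solver

  -- Reduces an inequality to an explicit nonnegative remainder, with an identity that the ring
  -- solver can check.
  ≤-from-diff : ∀ {p q d} → q ≡ p + d → 0ℚ ≤ d → p ≤ q
  ≤-from-diff {p} {q} {d} q≡ 0≤d =
    subst (p ≤_) (sym q≡) (subst (_≤ p + d) (ℚ.+-identityʳ p) (ℚ.+-monoʳ-≤ p 0≤d))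

  -- A term of the sequence of a nonnegative real may be slightly negative, hence `w + δ`. The
  -- conclusion is about the convex combination of `w + δ` and `δ` with coefficients `C` and
  -- `1 − C`.
  scale-nonNeg : ∀ {C w δ} → 0ℚ ≤ C → C ≤ 1ℚ → 0ℚ ≤ w + δ → 0ℚ ≤ δ → 0ℚ ≤ C * w + δ
  scale-nonNeg {C} {w} {δ} 0≤C C≤1 0≤w+δ 0≤δ = subst (0ℚ ≤_) (eq C w δ)
    (0≤-+ (0≤-* 0≤C 0≤w+δ) (0≤-* (0≤-diff C≤1) 0≤δ))
    where
    eq : ∀ C w δ → C * (w + δ) + (1ℚ - C) * δ ≡ C * w + δ
    eq = solve 3 (λ C w δ → C :* (w :+ δ) :+ (con 1ℚ :- C) :* δ := C :* w :+ δ) refl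
      where open +-*-Solver

  2ℚ : ℚ
  2ℚ = 1ℚ + 1ℚ

  -- With r = x (1 − x) y, the difference of the sides is (C − k r) (w + δ) + (3 − C + k r) δ;
  -- here ¼ − x (1 − x) = (x − ½)² bounds r above, and 2 + x (1 − x) = (2 − x) (1 + x) below.
  edge-bound : ∀ {k h C x y w δ} → 0ℚ ≤ k → (½ * ½) * (k * h) ≤ C → C ≤ 1ℚ → k * h ≤ 1ℚ →
    0ℚ ≤ x → x ≤ 2ℚ → 0ℚ ≤ y → y ≤ h → 0ℚ ≤ w + δ → 0ℚ ≤ δ →
    k * (x * (1ℚ - x) * (y * w)) ≤ C * w + (δ + δ + δ)
  edge-bound {k} {h} {C} {x} {y} {w} {δ} 0≤k kh≤4C C≤1 kh≤1 0≤x x≤2 0≤y y≤h 0≤w+δ 0≤δ =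
    ≤-from-diff (split k h C x y w δ) (0≤-+ (0≤-* 0≤C-kr 0≤w+δ) (0≤-* 0≤3-C+kr 0≤δ))
    where
    0≤C-kr : 0ℚ ≤ (C - (½ * ½) * (k * h)) + ((½ * ½) * k * (h - y) + k * ((x - ½) * (x - ½)) * y)
    0≤C-kr = 0≤-+ (0≤-diff kh≤4C)
      (0≤-+ (0≤-* (0≤-* (ℚ.nonNegative⁻¹ (½ * ½)) 0≤k) (0≤-diff y≤h))
            (0≤-* (0≤-* 0≤k (0≤-sq (x - ½))) 0≤y))
    0≤3-C+kr : 0ℚ ≤ (1ℚ - C) + 2ℚ * (1ℚ - k * h) + (k * ((2ℚ - x) * (1ℚ + x)) * y + 2ℚ * k * (h - y))
    0≤3-C+kr = 0≤-+ (0≤-+ (0≤-diff C≤1) (0≤-* (ℚ.nonNegative⁻¹ 2ℚ) (0≤-diff kh≤1)))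
      (0≤-+ (0≤-* (0≤-* 0≤k (0≤-* (0≤-diff x≤2) (0≤-+ (ℚ.nonNegative⁻¹ 1ℚ) 0≤x))) 0≤y)
            (0≤-* (0≤-* (ℚ.nonNegative⁻¹ 2ℚ) 0≤k) (0≤-diff y≤h)))
    split : ∀ k h C x y w δ → C * w + (δ + δ + δ) ≡ k * (x * (1ℚ - x) * (y * w)) +
      (((C - (½ * ½) * (k * h)) + ((½ * ½) * k * (h - y) + k * ((x - ½) * (x - ½)) * y)) * (w + δ) +
       ((1ℚ - C) + 2ℚ * (1ℚ - k * h) + (k * ((2ℚ - x) * (1ℚ + x)) * y + 2ℚ * k * (h - y))) * δ)
    split = solve 7 (λ k h C x y w δ →
      let 1′ = con 1ℚ ; ½′ = con ½ ; 2′ = con 2ℚ in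
      C :* w :+ (δ :+ δ :+ δ) := k :* (x :* (1′ :- x) :* (y :* w)) :+
      (((C :- (½′ :* ½′) :* (k :* h)) :+
        ((½′ :* ½′) :* k :* (h :- y) :+ k :* ((x :- ½′) :* (x :- ½′)) :* y)) :* (w :+ δ) :+
       ((1′ :- C) :+ 2′ :* (1′ :- k :* h) :+
        (k :* ((2′ :- x) :* (1′ :+ x)) :* y :+ 2′ :* k :* (h :- y))) :* δ)) refl
      where open +-*-Solver

open SemiringSum (CommutativeRing.semiring ℚ.+-*-commutativeRing)
  using (sum-cong-≗; *-distribˡ-sum) renaming (sum to sumℚ)

open import Data.Integer.Base using (+_)
open import Defs

-- From real revenues to the terms of their sequences.

seq-sum : ∀ {n} (f : Vector ℝ n) m → seq (sum f) m ≡ sumℚ λ i → seq (f i) m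
seq-sum {zero}  f m = refl
seq-sum {suc n} f m = cong (seq (f zero) m ℚ.+_) (seq-sum (f ∘ suc) m)

seq-product : ∀ {n} (f : Vector ℝ n) m → seq (product f) m ≡ ∏ λ i → seq (f i) m
seq-product {zero}  f m = refl
seq-product {suc n} f m = cong (seq (f zero) m ℚ.*_) (seq-product (f ∘ suc) m)

seq-sumList : ∀ {A : Set} (f : A → ℝ) xs m →
  seq (sumList (List.map f xs)) m ≡ sumOver xs λ x → seq (f x) m
seq-sumList f []       m = refl
seq-sumList f (x ∷ xs) m = cong (seq (f x) m ℚ.+_) (seq-sumList f xs m)

seq-mean : ∀ {A : Set} (f : A → ℝ) xs m →
  seq (mean (List.map f xs)) m ≡ meanOver xs λ x → seq (f x) m
seq-mean f []       m = refl
seq-mean f (x ∷ xs) m = cong₂ ℚ._*_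
  (cong (λ l → + 1 / suc l) (List.length-map f xs))
  (seq-sumList f (x ∷ xs) m)

seq-if : ∀ b {x} m → seq (if b then x else 0ℝ) m ≡ (if b then seq x m else 0ℚ)
seq-if true  m = refl
seq-if false m = refl

seqWeight : ∀ {n} → DirectedNetwork n → ℕ → Fin n → Fin n → ℚ
seqWeight G m j i = seq (weight G j i) m

-- Real arithmetic acts termwise, so at each index the revenue is that of rational weights and
-- prices, and the rational identities carry over.
seq-revenue : ∀ {n} (G : DirectedNetwork n) π p m →
  seq (revenue G π p) m ≡ revenueℚ (seqWeight G m) π λ i → seq (p i) m
seq-revenue {n} G π p m = trans (seq-sum terms m) (sum-cong-≗ λ i →
  cong (seq (p i * (1ℝ - p i)) m ℚ.*_)
    (trans (seq-sum (innerTerms i) m) (sum-cong-≗ λ j → seq-if (does (π ⟨$⟩ʳ j Fin.<? π ⟨$⟩ʳ i)) m)))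
  where
  innerTerms : Fin n → Vector ℝ n
  innerTerms i j = if does (π ⟨$⟩ʳ j Fin.<? π ⟨$⟩ʳ i) then p j * weight G j i else 0ℝ
  terms : Vector ℝ n
  terms i = p i * (1ℝ - p i) * sum (innerTerms i)

-- The probabilities must sum to 1 exactly at the index `m`, whereas `sum-prob` gives this only in
-- the limit; for constant sequences it holds by computation.
seq-ieRevenue : ∀ {n K} (G : DirectedNetwork n) (q : ProbabilityVector K) (p : Vector ℝ K) m
  (∑q≡1 : sumℚ (λ k → seq (prob q k) m) ≡ 1ℚ) →
  seq (ieRevenue G q p) m ≡
  IE.ieRevenueℚ (λ k → seq (prob q k) m) (λ k → seq (p k) m) ∑q≡1 (seqWeight G m)
seq-ieRevenue {n} {K} G q p m ∑q≡1 = trans (seq-sumList _ (allAssignments n K) m)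
  (sumOver-cong (allAssignments n K) λ c → cong₂ ℚ._*_
    (seq-product (prob q ∘ c) m)
    (trans (seq-mean (λ π → revenue G π (p ∘ c)) (compatibles c) m)
      (meanOver-cong (compatibles c) λ π → seq-revenue G π (p ∘ c) m)))

-- Order on the reals, and the comparison of one edge.

eventually-∧ : ∀ {P Q : ℕ → Set} → Eventually P → Eventually Q → Eventually λ n → P n × Q n
eventually-∧ (M , p) (N , q) = M ℕ.⊔ N , λ n ≤n →
  p n (ℕ.m⊔n≤o⇒m≤o M N ≤n) , q n (ℕ.m⊔n≤o⇒n≤o M N ≤n)

eventually-map : ∀ {P Q : ℕ → Set} → (∀ {n} → P n → Q n) → Eventually P → Eventually Q
eventually-map f (N , p) = N , λ n ≤n → f (p n ≤n)

≤-resp-≗ : ∀ {x x′ y y′} →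
  (∀ m → seq x m ≡ seq x′ m) → (∀ m → seq y m ≡ seq y′ m) → x′ ≤ y′ → x ≤ y
≤-resp-≗ x≗ y≗ x≤y = mk≤ λ ε 0<ε → eventually-map
  (λ {n} → subst₂ ℚ._≤_ (sym (x≗ n)) (cong (ℚ._+ ε) (sym (y≗ n)))) (below x≤y ε 0<ε)

0<* : ∀ c .{{_ : ℚ.Positive c}} {ε} → 0ℚ ℚ.< ε → 0ℚ ℚ.< c ℚ.* ε
0<* c {ε} 0<ε = subst (ℚ._< c ℚ.* ε) (ℚ.*-zeroʳ c) (ℚ.*-monoʳ-<-pos c 0<ε)

+-mono-≤ : ∀ {w x y z} → w ≤ x → y ≤ z → w + y ≤ x + z
+-mono-≤ {w} {x} {y} {z} w≤x y≤z = mk≤ λ ε 0<ε → eventually-map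
  (λ {n} (p , q) → subst (seq w n ℚ.+ seq y n ℚ.≤_) (regroup (seq x n) (seq z n) ε) (ℚ.+-mono-≤ p q))
  (eventually-∧ (below w≤x (½ ℚ.* ε) (0<* ½ 0<ε)) (below y≤z (½ ℚ.* ε) (0<* ½ 0<ε)))
  where
  regroup : ∀ a b ε → (a ℚ.+ ½ ℚ.* ε) ℚ.+ (b ℚ.+ ½ ℚ.* ε) ≡ (a ℚ.+ b) ℚ.+ ε
  regroup = solve 3 (λ a b ε → (a :+ con ½ :* ε) :+ (b :+ con ½ :* ε) := (a :+ b) :+ ε) refl
    where open +-*-Solver

sum-mono-≤ : ∀ {n} {f g : Vector ℝ n} → (∀ i → f i ≤ g i) → sum f ≤ sum g
sum-mono-≤ {zero}  f≤g = fromℚ-mono-≤ ℚ.≤-refl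
sum-mono-≤ {suc n} f≤g = +-mono-≤ (f≤g zero) (sum-mono-≤ (f≤g ∘ suc))

p≤∣p∣ : ∀ p → p ℚ.≤ ℚ.∣ p ∣
p≤∣p∣ p with ℚ.≤-total 0ℚ p
... | inj₁ 0≤p = ℚ.≤-reflexive (sym (ℚ.0≤p⇒∣p∣≡p 0≤p))
... | inj₂ p≤0 = ℚ.≤-trans p≤0 (ℚ.0≤∣p∣ p)

-- Half of the tolerance pays for replacing `x` by `y`, since a factor `k` of at most 1 does not
-- enlarge that error, and half pays for the given inequality.
scale-≤-resp-≃ : ∀ {k x y z} → 0ℚ ℚ.≤ k → k ℚ.≤ 1ℚ → x ≃ y → fromℚ k * x ≤ z → fromℚ k * y ≤ z
scale-≤-resp-≃ {k} {x} {y} {z} 0≤k k≤1 x≃y kx≤z = mk≤ λ ε 0<ε → eventually-map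
  (λ {n} (p , q) → step ε (seq x n) (seq y n) (seq z n) (ℚ.<⇒≤ 0<ε) p q)
  (eventually-∧ (close x≃y (½ ℚ.* ε) (0<* ½ 0<ε)) (below kx≤z (½ ℚ.* ε) (0<* ½ 0<ε)))
  where
  open import Data.Rational.Base using () renaming (_+_ to _⊕_; _*_ to _⊗_; _-_ to _⊖_)
  step : ∀ ε a b c → 0ℚ ℚ.≤ ε → ℚ.∣ a ⊖ b ∣ ℚ.≤ ½ ⊗ ε → k ⊗ a ℚ.≤ c ⊕ ½ ⊗ ε → k ⊗ b ℚ.≤ c ⊕ ε
  step ε a b c 0≤ε ∣a-b∣≤ ka≤ = ≤-from-diff (eq k ε a b c)
    (0≤-+ (0≤-diff ka≤)
      (0≤-+ (0≤-* 0≤k (0≤-diff b-a≤)) (0≤-* (0≤-diff k≤1) (0≤-* (ℚ.nonNegative⁻¹ ½) 0≤ε))))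
    where
    flip-diff : ∀ a b → ℚ.- (a ⊖ b) ≡ b ⊖ a
    flip-diff = solve 2 (λ a b → :- (a :- b) := b :- a) refl
      where open +-*-Solver
    b-a≤ : b ⊖ a ℚ.≤ ½ ⊗ ε
    b-a≤ = ℚ.≤-trans (p≤∣p∣ (b ⊖ a))
      (subst (ℚ._≤ ½ ⊗ ε) (trans (sym (ℚ.∣-p∣≡∣p∣ (a ⊖ b))) (cong ℚ.∣_∣ (flip-diff a b))) ∣a-b∣≤)
    eq : ∀ k ε a b c → c ⊕ ε ≡
      k ⊗ b ⊕ (((c ⊕ ½ ⊗ ε) ⊖ k ⊗ a) ⊕ (k ⊗ (½ ⊗ ε ⊖ (b ⊖ a)) ⊕ (1ℚ ⊖ k) ⊗ (½ ⊗ ε)))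
    eq = solve 5 (λ k ε a b c → c :+ ε :=
      k :* b :+ (((c :+ con ½ :* ε) :- k :* a) :+
        (k :* (con ½ :* ε :- (b :- a)) :+ (con 1ℚ :- k) :* (con ½ :* ε)))) refl
      where open +-*-Solver

-- Covers the pairs in which `j` does not precede `i`: the strategy earns nothing from them, and the
-- other side is nonnegative.
edge-zero-≤ : ∀ {C k w} x → 0ℚ ℚ.≤ C → C ℚ.≤ 1ℚ → 0ℝ ≤ w → fromℚ k * (x * 0ℝ) ≤ fromℚ C * w
edge-zero-≤ {C} {k} {w} x 0≤C C≤1 0≤w = mk≤ λ ε 0<ε → eventually-map
  (λ {n} 0≤w+ε → subst (ℚ._≤ C ℚ.* seq w n ℚ.+ ε) (sym (vanish k (seq x n)))
    (scale-nonNeg 0≤C C≤1 0≤w+ε (ℚ.<⇒≤ 0<ε)))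
  (below 0≤w ε 0<ε)
  where
  vanish : ∀ k x → k ℚ.* (x ℚ.* 0ℚ) ≡ 0ℚ
  vanish = solve 2 (λ k x → k :* (x :* con 0ℚ) := con 0ℚ) refl
    where open +-*-Solver

-- Eventually the terms of both prices lie between 0 and `1 + η`, and that of the weight is at least
-- `−ε/3`. Then `edge-bound` with `h = 1 + η` and `δ = ε/3` costs exactly the tolerance `ε`.
edge-≤ : ∀ {k C η x y w} → 0ℚ ℚ.≤ k → 0ℚ ℚ.< η → η ℚ.≤ 1ℚ →
  (½ ℚ.* ½) ℚ.* (k ℚ.* (1ℚ ℚ.+ η)) ℚ.≤ C → C ℚ.≤ 1ℚ → k ℚ.* (1ℚ ℚ.+ η) ℚ.≤ 1ℚ →
  fromℚ ½ ≤ x → x ≤ 1ℝ → fromℚ ½ ≤ y → y ≤ 1ℝ → 0ℝ ≤ w →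
  fromℚ k * (x * (1ℝ - x) * (y * w)) ≤ fromℚ C * w
edge-≤ {k} {C} {η} {x} {y} {w} 0≤k 0<η η≤1 kh≤4C C≤1 kh≤1 ½≤x x≤1 ½≤y y≤1 0≤w =
  mk≤ λ ε 0<ε → eventually-map
    (λ {n} ((½≤xₙ , xₙ≤1) , (½≤yₙ , yₙ≤1) , 0≤wₙ) →
      subst (λ e → k ℚ.* (seq x n ℚ.* (1ℚ ℚ.- seq x n) ℚ.* (seq y n ℚ.* seq w n)) ℚ.≤ C ℚ.* seq w n ℚ.+ e)
        (thirds ε)
        (edge-bound 0≤k kh≤4C C≤1 kh≤1
          (cancel-½ ½≤xₙ) (ℚ.≤-trans xₙ≤1 (ℚ.+-monoʳ-≤ 1ℚ η≤1))
          (cancel-½ ½≤yₙ) yₙ≤1 0≤wₙ (ℚ.<⇒≤ (0<* ⅓ 0<ε))))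
    (eventually-∧ (range ½≤x x≤1) (eventually-∧ (range ½≤y y≤1) (below 0≤w (⅓ ℚ.* ε) (0<* ⅓ 0<ε))))
  where
  ⅓ : ℚ
  ⅓ = + 1 / 3
  thirds : ∀ ε → ⅓ ℚ.* ε ℚ.+ ⅓ ℚ.* ε ℚ.+ ⅓ ℚ.* ε ≡ ε
  thirds = solve 1 (λ ε → con ⅓ :* ε :+ con ⅓ :* ε :+ con ⅓ :* ε := ε) refl
    where open +-*-Solver
  cancel-½ : ∀ {p} → ½ ℚ.≤ p ℚ.+ ½ → 0ℚ ℚ.≤ p
  cancel-½ {p} ½≤p+½ = subst (0ℚ ℚ.≤_) (cancel p) (0≤-diff ½≤p+½)
    where
    cancel : ∀ p → (p ℚ.+ ½) ℚ.- ½ ≡ p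
    cancel = solve 1 (λ p → (p :+ con ½) :- con ½ := p) refl
      where open +-*-Solver
  -- Tolerance ½ turns the lower price bound into nonnegativity. The tolerance `η` above does not
  -- shrink with `ε`; the hypothesis comparing a quarter of `k (1 + η)` with `C` absorbs it.
  range : ∀ {z} → fromℚ ½ ≤ z → z ≤ 1ℝ → Eventually λ n →
    (½ ℚ.≤ seq z n ℚ.+ ½) × (seq z n ℚ.≤ 1ℚ ℚ.+ η)
  range ½≤z z≤1 = eventually-∧ (below ½≤z ½ (ℚ.positive⁻¹ ½)) (below z≤1 η 0<η)

-- Numerical constants of the six-class strategy.

-- These sequences are constant, so the index 0 represents every index definitionally.
sixProbs sixPrices : Vector ℚ 6
sixProbs k = seq (prob sixClassProbabilities k) 0
sixPrices k = seq (classPrice {4} k) 0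

open IE sixProbs sixPrices refl

-- The `slack` is the fixed η of the overview. It must keep 0.3516 (1 + η) at most 4C = 0.351612678,
-- which leaves room for η up to about 0.000036.
ratio slack : ℚ
ratio = + 3516 / 10000
slack = + 1 / 100000

-- Decided by evaluation: 0.087900879 against 0.0879031695.
edgeRevenue-lower : (½ ℚ.* ½) ℚ.* (ratio ℚ.* (1ℚ ℚ.+ slack)) ℚ.≤ edgeRevenue
edgeRevenue-lower = from-yes ((½ ℚ.* ½) ℚ.* (ratio ℚ.* (1ℚ ℚ.+ slack)) ℚ.≤? edgeRevenue)

edgeRevenue≤1 : edgeRevenue ℚ.≤ 1ℚ
edgeRevenue≤1 = from-yes (edgeRevenue ℚ.≤? 1ℚ)

0≤edgeRevenue : 0ℚ ℚ.≤ edgeRevenue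
0≤edgeRevenue = from-yes (0ℚ ℚ.≤? edgeRevenue)

-- Edgewise comparison of an arbitrary strategy with the generalized IE strategy.

module _ {n} (G : DirectedNetwork n) (s : Strategy n) where
  open Strategy s

  lowerTerm upperTerm : Fin n → Fin n → ℝ
  lowerTerm i j = fromℚ ratio * (price i * (1ℝ - price i) *
    (if does (order ⟨$⟩ʳ j Fin.<? order ⟨$⟩ʳ i) then price j * weight G j i else 0ℝ))
  upperTerm i j = fromℚ (pairRevenue i j) * weight G j i

  -- Not a with-abstraction, since that normalises edgeRevenue in the goal, which is infeasible.
  lowerTerm≤upperTerm : ∀ i j → lowerTerm i j ≤ upperTerm i j
  lowerTerm≤upperTerm i j = cases (i Fin.≟ j)
    where
    cases : ∀ (i≟j : Dec (i ≡ j)) →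
      lowerTerm i j ≤ fromℚ (if does i≟j then 0ℚ else edgeRevenue) * weight G j i
    cases (yes refl) = subst
      (λ b → fromℚ ratio * (price i * (1ℝ - price i) * (if b then price i * weight G i i else 0ℝ)) ≤
        fromℚ 0ℚ * weight G i i)
      (sym (dec-false (order ⟨$⟩ʳ i Fin.<? order ⟨$⟩ʳ i) (ℕ.<-irrefl refl)))
      (edge-zero-≤ (price i * (1ℝ - price i)) ℚ.≤-refl (ℚ.nonNegative⁻¹ 1ℚ) (nonNegative G i i))
    cases (no _) = edge (does (order ⟨$⟩ʳ j Fin.<? order ⟨$⟩ʳ i))
      where
      edge : ∀ b → fromℚ ratio * (price i * (1ℝ - price i) * (if b then price j * weight G j i else 0ℝ)) ≤
             fromℚ edgeRevenue * weight G j i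
      edge true  = edge-≤ (ℚ.nonNegative⁻¹ ratio) (ℚ.positive⁻¹ slack) (from-yes (slack ℚ.≤? 1ℚ))
        edgeRevenue-lower edgeRevenue≤1 (from-yes (ratio ℚ.* (1ℚ ℚ.+ slack) ℚ.≤? 1ℚ))
        (½≤p i) (p≤1 i) (½≤p j) (p≤1 j) (nonNegative G j i)
      edge false = edge-zero-≤ (price i * (1ℝ - price i)) 0≤edgeRevenue edgeRevenue≤1 (nonNegative G j i)

  seq-∑∑ : ∀ (f : Fin n → Fin n → ℝ) m →
    seq (sum λ i → sum (f i)) m ≡ sumℚ λ i → sumℚ λ j → seq (f i j) m
  seq-∑∑ f m = trans (seq-sum (λ i → sum (f i)) m) (sum-cong-≗ λ i → seq-sum (f i) m)

  seq-lower : ∀ m → seq (fromℚ ratio * strategyRevenue G s) m ≡ seq (sum λ i → sum (lowerTerm i)) m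
  seq-lower m = begin
    ratio ℚ.* seq (strategyRevenue G s) m
      ≡⟨ cong (ratio ℚ.*_) (seq-sum (λ i → a i * sum (b i)) m) ⟩
    ratio ℚ.* sumℚ (λ i → seq (a i) m ℚ.* seq (sum (b i)) m)
      ≡⟨ *-distribˡ-sum ratio (λ i → seq (a i) m ℚ.* seq (sum (b i)) m) ⟩
    sumℚ (λ i → ratio ℚ.* (seq (a i) m ℚ.* seq (sum (b i)) m))
      ≡⟨ sum-cong-≗ (λ i → trans
           (cong (λ x → ratio ℚ.* (seq (a i) m ℚ.* x)) (seq-sum (b i) m))
           (trans (cong (ratio ℚ.*_) (*-distribˡ-sum (seq (a i) m) (λ j → seq (b i j) m)))
             (*-distribˡ-sum ratio (λ j → seq (a i) m ℚ.* seq (b i j) m)))) ⟩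
    sumℚ (λ i → sumℚ λ j → seq (lowerTerm i j) m)
      ≡⟨ seq-∑∑ lowerTerm m ⟨
    seq (sum λ i → sum (lowerTerm i)) m
      ∎
    where
    open ≡-Reasoning
    a : Vector ℝ n
    a i = price i * (1ℝ - price i)
    b : Fin n → Vector ℝ n
    b i j = if does (order ⟨$⟩ʳ j Fin.<? order ⟨$⟩ʳ i) then price j * weight G j i else 0ℝ

  seq-upper : ∀ m → seq (ieRevenue G sixClassProbabilities classPrice) m ≡
    seq (sum λ i → sum (upperTerm i)) m
  seq-upper m = trans (seq-ieRevenue G sixClassProbabilities classPrice m refl)
    (trans (ieRevenueℚ-linear (seqWeight G m)) (sym (seq-∑∑ upperTerm m)))

  -- At every index both sides equal double sums over the same pairs of buyers, so comparing them
  -- pair by pair suffices.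
  strategyRevenue-≤ : fromℚ ratio * strategyRevenue G s ≤ ieRevenue G sixClassProbabilities classPrice
  strategyRevenue-≤ = ≤-resp-≗ seq-lower seq-upper
    (sum-mono-≤ λ i → sum-mono-≤ (lowerTerm≤upperTerm i))

corollary1 : ∀ (n : ℕ) (G : DirectedNetwork n) →
    (∀ (Rmax : ℝ) → IsMaximumRevenue G Rmax →
    fromℚ (+ 3516 / 10000) * Rmax ≤ ieRevenue G sixClassProbabilities classPrice)
    × (∀ (s : Strategy n) →
    fromℚ (+ 3516 / 10000) * strategyRevenue G s ≤ ieRevenue G sixClassProbabilities classPrice)
corollary1 n G =
    -- The maximum is attained by some `s`, up to `_≃_`, so the bound for `s` transfers to it.
    (λ { Rmax ((s , R≃Rmax) , _) → scale-≤-resp-≃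
           (ℚ.nonNegative⁻¹ ratio) (from-yes (ratio ℚ.≤? 1ℚ)) R≃Rmax (strategyRevenue-≤ G s) })
  , strategyRevenue-≤ G
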